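{- Let $X=\{ -1,-2,-3,\dots\}$. For an integer $a\ge 1$, let $f_a:\mathbb{C}\to\mathbb{C}$ be given by $f_a(x)=\dfrac{1}{x^a}$ for $x\neq0$ and $f_a(0)=0$, and let $f_a':\mathbb{C}\to\mathbb{C}$ be given by $f_a'(x)=-\dfrac{a}{x^{a+1}}$ for $x\ne0$ and $f_a'(0)=0$. If there exists a summable set $\mathcal{U}$ such that $\{f_a,f_a'\}\subset\mathbf{S}(\mathcal{U})$, then $\mathrm{ess}(f_a)=a\,\zeta(a+1)$ and $$\frac{d}{dx}\,\Sigma_{\mathcal{U}}(f_a;1,x)=\mathrm{ess}(f_a)+\Sigma_{\mathcal{U}}(f_a';1,x)$$ for all $x\in\mathbb{C}\setminus X$. Here $\zeta$ is the Riemann zeta function and $\mathrm{ess}$ is the essence relative to $\mathcal{U}$.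
   Context: Sets of functions. $\mathbb{C}^{\mathbb{C}}$ is the set of all functions $\mathbb{C}\to\mathbb{C}$. For $X\subset\mathbb{C}^{\mathbb{C}}$: $\mathbf{L}(X)$ is the set of all (finite, complex) linear combinations of functions in $X$; $\mathbf{T}(X)$ is the set of all translates $x\mapsto g(x+c)$ with $g\in X$, $c\in\mathbb{C}$; and $\mathbf{S}(X):=\mathbf{L}(\mathbf{T}(X))$. Polynomial sums. For a complex polynomial $p$, let $P$ be the unique polynomial with $P(z)-P(z-1)=p(z)$ for all $z$ and $P(0)=0$; the fractional sum of $p$ from $x$ to $y$ is $P(y)-P(x-1)$, for $x,y\in\mathbb{C}$. Fractional summable functions. $f:\mathbb{C}\to\mathbb{C}$ is fractional summable if there are a degree bound $m$ and a sequence $(p_n)_{n\in\mathbb{N}}$ of polynomials of degree $\le m$ (the null polynomial has degree $-\infty$) such that $|f(n+x)-p_n(n+x)|\to 0$ as $n\to\infty$ for all $x\in\mathbb{C}$, and such that for all $x,y\in\mathbb{C}$ the limit as $n\to\infty$ of (fractional sum of $p_n$ from $n+x$ to $n+y$) $+\sum_{\nu=1}^n\bigl(f(\nu+x-1)-f(\nu+y)\bigr)$ exists. $\mathcal{F}$ is the set of functions $\mathbb{C}\to\mathbb{C}$ that are linear combinations of holomorphic (entire) functions and fractional summable functions. Summable sets. A set $\mathcal{U}\subset\mathcal{F}$ is a summable set if there is a unique map $\Sigma_{\mathcal{U}}:\mathbf{S}(\mathcal{U})\times\mathbb{C}^2\to\mathbb{C}$, $(f,x,y)\mapsto\Sigma_{\mathcal{U}}(f;x,y)$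 (thought of as "$\sum_{k=x}^y f(k)$"), satisfying, for all $f,g\in\mathbf{S}(\mathcal{U})$ and $x,y,z,s,\lambda,\mu\in\mathbb{C}$: (A1) $\Sigma_{\mathcal{U}}(f;x,y)+\Sigma_{\mathcal{U}}(f;y+1,z)=\Sigma_{\mathcal{U}}(f;x,z)$; (A2) $\Sigma_{\mathcal{U}}(f;x+s,y+s)=\Sigma_{\mathcal{U}}(h;x,y)$ where $h(t)=f(t+s)$; (A3) $\Sigma_{\mathcal{U}}(\lambda f+\mu g;x,y)=\lambda\Sigma_{\mathcal{U}}(f;x,y)+\mu\Sigma_{\mathcal{U}}(g;x,y)$; (A4) $\Sigma_{\mathcal{U}}(f;1,1)=f(1)$; (A5*) if $f$ is holomorphic, then $x\mapsto\Sigma_{\mathcal{U}}(f;1,x)$ is holomorphic on $\mathbb{C}$; (A6) if $\lim_{n\to\infty}f(t+n)=0$ for every $t\in\mathbb{C}$, then $\lim_{n\to\infty}\Sigma_{\mathcal{U}}(f(\cdot+n);x,y)=0$; moreover, if there is a sequence $(p_n)$ of polynomials of fixed degree (independent of $n$) with $|f(t+n)-p_n(t+n)|\to0$ for all $t\in\mathbb{C}$, then $\Sigma_{\mathcal{U}}(f(\cdot+n);x,y)$ minus the fractional sum of the polynomial $p_n(\cdot+n)$ from $x$ to $y$ tends to $0$ as $n\to\infty$. The map $\Sigma_{\mathcal{U}}$ is called the fractional sum relative to $\mathcal{U}$. Essence. For $f\in\mathbf{S}(\mathcal{U})$, the essence of $f$ relative to $\mathcal{U}$ is $\mathrm{ess}(f):=\lim_{h\to0}\frac1h\Sigma_{\mathcal{U}}(f;1,h)$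 ($h\in\mathbb{C}\setminus\{0\}$), if the limit exists; then $f$ is said to be a function with essence in $\mathcal{U}$. -}

module Defs where

open import Algebra.Bundles using (CommutativeRing; AbelianGroup)
import Algebra.Construct.DirectProduct as DirectProduct
import Algebra.Properties.Ring as RingProperties
import Algebra.Properties.Semiring.Exp as Exp
import Algebra.Properties.Semiring.Mult as Mult
import Algebra.Solver.Ring.NaturalCoefficients.Default as SemiringSolver
open import Data.List.Base using (List; []; _∷_; _++_; map)
open import Data.Maybe.Base using (Maybe; just; nothing)
open import Data.Nat.Base as ℕ using (ℕ; zero; suc)
open import Data.Product.Base using (Σ; ∃; _,_; _×_; proj₁; proj₂)
open import Data.Product.Relation.Binary.Pointwise.NonDependent using (_×ₛ_; ×-decidable)
open import Function.Bundles using (Func; _⟨$⟩_)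
import Function.Relation.Binary.Setoid.Equality as FunctionEquality
open import Level using (Level; _⊔_) renaming (suc to lsuc)
open import Relation.Binary.Bundles using (Setoid)
import Relation.Binary.Construct.On as On
open import Relation.Binary.Core using (Rel)
open import Relation.Binary.Definitions using (Decidable; tri<; tri≈; tri>)
import Relation.Binary.Reasoning.Setoid as SetoidReasoning
open import Relation.Binary.Structures using (IsStrictTotalOrder)
open import Relation.Nullary using (¬_; yes; no; contradiction)
open import Relation.Unary using (Pred; _∈_; _⊆_; _∪_)

-- The real numbers are, up to isomorphism, the Archimedean ordered field in
-- which every Cauchy sequence converges.  Trichotomy of _<_ makes this the
-- classical notion.

record CompleteOrderedField c ℓ : Set (lsuc (c ⊔ ℓ)) where
  infix 4 _<_
  field
    commutativeRing : CommutativeRing c ℓ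
  open CommutativeRing commutativeRing public
  open Mult semiring public using () renaming (_×_ to _×ᴺ_)
  field
    _<_                : Rel Carrier ℓ
    isStrictTotalOrder : IsStrictTotalOrder _≈_ _<_
    1≉0                : ¬ 1# ≈ 0#
    +-monoʳ-<          : ∀ x {y z} → y < z → x + y < x + z
    *-positive         : ∀ {x y} → 0# < x → 0# < y → 0# < x * y
    inverse            : ∀ x → ¬ x ≈ 0# → ∃ λ y → x * y ≈ 1#
    archimedean        : ∀ x → ∃ λ n → x < n ×ᴺ 1#

  Near : Carrier → Rel Carrier ℓ
  Near ε x y = (x - y < ε) × (y - x < ε)

  field
    complete :
      ∀ (s : ℕ → Carrier) →
      (∀ ε → 0# < ε → ∃ λ N → ∀ m n → N ℕ.≤ m → N ℕ.≤ n → Near ε (s m) (s n)) →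
      ∃ λ l → ∀ ε → 0# < ε → ∃ λ N → ∀ n → N ℕ.≤ n → Near ε (s n) l

module RealProperties {c ℓ} (ℝ : CompleteOrderedField c ℓ) where
  open CompleteOrderedField ℝ
  open IsStrictTotalOrder isStrictTotalOrder using (compare; _≟_; irrefl; <-respʳ-≈; <-respˡ-≈)
    renaming (trans to <-trans)
  open RingProperties ring
  open SetoidReasoning setoid

  inv : Carrier → Carrier
  inv x with x ≟ 0#
  ... | yes _  = 0#
  ... | no x≉0 = proj₁ (inverse x x≉0)

  inv-inverse : ∀ x → ¬ x ≈ 0# → x * inv x ≈ 1#
  inv-inverse x x≉0 with x ≟ 0#
  ... | yes x≈0 = contradiction x≈0 x≉0
  ... | no x≉0′ = proj₂ (inverse x x≉0′)

  inv-cong : ∀ {x y} → x ≈ y → inv x ≈ inv y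
  inv-cong {x} {y} x≈y with x ≟ 0# | y ≟ 0#
  ... | yes _   | yes _   = refl
  ... | yes x≈0 | no y≉0  = contradiction (trans (sym x≈y) x≈0) y≉0
  ... | no x≉0  | yes y≈0 = contradiction (trans x≈y y≈0) x≉0
  ... | no x≉0  | no y≉0  with inverse x x≉0 | inverse y y≉0
  ...   | u , xu≈1 | v , yv≈1 = begin
    u            ≈⟨ *-identityʳ u ⟨
    u * 1#       ≈⟨ *-congˡ yv≈1 ⟨
    u * (y * v)  ≈⟨ *-assoc u y v ⟨
    (u * y) * v  ≈⟨ *-congʳ (*-congˡ x≈y) ⟨
    (u * x) * v  ≈⟨ *-congʳ (*-comm u x) ⟩
    (x * u) * v  ≈⟨ *-congʳ xu≈1 ⟩
    1# * v       ≈⟨ *-identityˡ v ⟩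
    v            ∎

  +-positive : ∀ {x y} → 0# < x → 0# < y → 0# < x + y
  +-positive {x} {y} 0<x 0<y =
    <-trans 0<x (<-respˡ-≈ (+-identityʳ x) (+-monoʳ-< x 0<y))

  negative⇒positive : ∀ {x} → x < 0# → 0# < - x
  negative⇒positive {x} x<0 =
    <-respˡ-≈ (-‿inverseˡ x) (<-respʳ-≈ (+-identityʳ (- x)) (+-monoʳ-< (- x) x<0))

  square-positive : ∀ {x} → ¬ x ≈ 0# → 0# < x * x
  square-positive {x} x≉0 with compare x 0#
  ... | tri< x<0 _ _ = <-respʳ-≈ -x-x≈xx (*-positive 0<-x 0<-x)
    where
    0<-x = negative⇒positive x<0
    -x-x≈xx : - x * - x ≈ x * x
    -x-x≈xx = begin
      - x * - x      ≈⟨ -‿distribˡ-* x (- x) ⟨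
      - (x * - x)    ≈⟨ -‿cong (-‿distribʳ-* x x) ⟨
      - (- (x * x))  ≈⟨ -‿involutive (x * x) ⟩
      x * x          ∎
  ... | tri≈ _ x≈0 _ = contradiction x≈0 x≉0
  ... | tri> _ _ 0<x = *-positive 0<x 0<x

  positive⇒≉0 : ∀ {x} → 0# < x → ¬ x ≈ 0#
  positive⇒≉0 0<x x≈0 = irrefl (sym x≈0) 0<x

  sum-of-squares≉0 : ∀ x y → ¬ (x ≈ 0# × y ≈ 0#) → ¬ x * x + y * y ≈ 0#
  sum-of-squares≉0 x y ¬both with x ≟ 0# | y ≟ 0#
  ... | yes x≈0 | yes y≈0 = contradiction (x≈0 , y≈0) ¬both
  ... | yes x≈0 | no y≉0  = positive⇒≉0 (<-respʳ-≈ yy≈ (square-positive y≉0))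
    where
    yy≈ : y * y ≈ x * x + y * y
    yy≈ = trans (sym (+-identityˡ _)) (+-congʳ (sym (trans (*-congʳ x≈0) (zeroˡ x))))
  ... | no x≉0  | yes y≈0 = positive⇒≉0 (<-respʳ-≈ xx≈ (square-positive x≉0))
    where
    xx≈ : x * x ≈ x * x + y * y
    xx≈ = trans (sym (+-identityʳ _)) (+-congˡ (sym (trans (*-congʳ y≈0) (zeroˡ y))))
  ... | no x≉0  | no y≉0  =
    positive⇒≉0 (+-positive (square-positive x≉0) (square-positive y≉0))

  suc×1≉0 : ∀ n → ¬ suc n ×ᴺ 1# ≈ 0#
  suc×1≉0 n = positive⇒≉0 (go n)
    where
    0<1 : 0# < 1#
    0<1 = <-respʳ-≈ (*-identityˡ 1#) (square-positive 1≉0)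
    go : ∀ m → 0# < suc m ×ᴺ 1#
    go zero    = <-respʳ-≈ (sym (+-identityʳ 1#)) 0<1
    go (suc m) = +-positive 0<1 (go m)

module ComplexRing {c ℓ} (ℝ : CompleteOrderedField c ℓ) where
  private
    module ℝ = CompleteOrderedField ℝ

    open SemiringSolver ℝ.commutativeSemiring using (solve; _:=_; _:+_; _:*_)

    -- The solver has no negation, so - x is presented to it as m * x.
    m : ℝ.Carrier
    m = ℝ.- ℝ.1#

    neg : ∀ {x} → ℝ.- x ℝ.≈ m ℝ.* x
    neg {x} = ℝ.sym (RingProperties.-1*x≈-x ℝ.ring x)

    additiveGroup : AbelianGroup c ℓ
    additiveGroup = DirectProduct.abelianGroup ℝ.+-abelianGroup ℝ.+-abelianGroup

    open AbelianGroup additiveGroup using (Carrier; _≈_)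

    mul : Carrier → Carrier → Carrier
    mul (a , b) (a′ , b′) = a ℝ.* a′ ℝ.- b ℝ.* b′ , a ℝ.* b′ ℝ.+ b ℝ.* a′

    one : Carrier
    one = ℝ.1# , ℝ.0#

    mul-cong : ∀ {x y u v} → x ≈ y → u ≈ v → mul x u ≈ mul y v
    mul-cong (p , q) (r , s) =
      ℝ.+-cong (ℝ.*-cong p r) (ℝ.-‿cong (ℝ.*-cong q s)) ,
      ℝ.+-cong (ℝ.*-cong p s) (ℝ.*-cong q r)

    mul-assoc : ∀ x y z → mul (mul x y) z ≈ mul x (mul y z)
    mul-assoc (a , b) (a′ , b′) (a″ , b″) =
      ℝ.trans (ℝ.+-cong (ℝ.*-congʳ (ℝ.+-congˡ neg)) neg)
        (ℝ.trans
          (solve 7 (λ m a b c d e f →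
            (a :* c :+ m :* (b :* d)) :* e :+ m :* ((a :* d :+ b :* c) :* f)
            := a :* (c :* e :+ m :* (d :* f)) :+ m :* (b :* (c :* f :+ d :* e)))
            ℝ.refl m a b a′ b′ a″ b″)
          (ℝ.sym (ℝ.+-cong (ℝ.*-congˡ (ℝ.+-congˡ neg)) neg))) ,
      ℝ.trans (ℝ.+-congʳ (ℝ.*-congʳ (ℝ.+-congˡ neg)))
        (ℝ.trans
          (solve 7 (λ m a b c d e f →
            (a :* c :+ m :* (b :* d)) :* f :+ (a :* d :+ b :* c) :* e
            := a :* (c :* f :+ d :* e) :+ b :* (c :* e :+ m :* (d :* f)))
            ℝ.refl m a b a′ b′ a″ b″)
          (ℝ.sym (ℝ.+-congˡ (ℝ.*-congˡ (ℝ.+-congˡ neg)))))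

    mul-comm : ∀ x y → mul x y ≈ mul y x
    mul-comm (a , b) (a′ , b′) =
      ℝ.+-cong (ℝ.*-comm a a′) (ℝ.-‿cong (ℝ.*-comm b b′)) ,
      solve 4 (λ a b c d → a :* d :+ b :* c := c :* b :+ d :* a) ℝ.refl a b a′ b′

    mul-identityˡ : ∀ x → mul one x ≈ x
    mul-identityˡ (a , b) =
      ℝ.trans (ℝ.+-cong (ℝ.*-identityˡ a)
                        (ℝ.trans (ℝ.-‿cong (ℝ.zeroˡ b)) (RingProperties.-0#≈0# ℝ.ring)))
              (ℝ.+-identityʳ a) ,
      ℝ.trans (ℝ.+-cong (ℝ.*-identityˡ b) (ℝ.zeroˡ a)) (ℝ.+-identityʳ b)

    mul-distribˡ : ∀ x y z → mul x (y .proj₁ ℝ.+ z .proj₁ , y .proj₂ ℝ.+ z .proj₂)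
                   ≈ (mul x y .proj₁ ℝ.+ mul x z .proj₁ , mul x y .proj₂ ℝ.+ mul x z .proj₂)
    mul-distribˡ (a , b) (a′ , b′) (a″ , b″) =
      ℝ.trans (ℝ.+-congˡ neg)
        (ℝ.trans
          (solve 7 (λ m a b c d e f →
            a :* (c :+ e) :+ m :* (b :* (d :+ f))
            := (a :* c :+ m :* (b :* d)) :+ (a :* e :+ m :* (b :* f)))
            ℝ.refl m a b a′ b′ a″ b″)
          (ℝ.sym (ℝ.+-cong (ℝ.+-congˡ neg) (ℝ.+-congˡ neg)))) ,
      solve 6 (λ a b c d e f →
        a :* (d :+ f) :+ b :* (c :+ e)
        := (a :* d :+ b :* c) :+ (a :* f :+ b :* e))
        ℝ.refl a b a′ b′ a″ b″

  ℂ-commutativeRing : CommutativeRing c ℓ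
  ℂ-commutativeRing = record
    { Carrier = Carrier
    ; _≈_     = _≈_
    ; _+_     = AbelianGroup._∙_ additiveGroup
    ; _*_     = mul
    ; -_      = AbelianGroup._⁻¹ additiveGroup
    ; 0#      = AbelianGroup.ε additiveGroup
    ; 1#      = one
    ; isCommutativeRing = record
      { isRing = record
        { +-isAbelianGroup = AbelianGroup.isAbelianGroup additiveGroup
        ; *-cong           = λ {x} {y} {u} {v} → mul-cong {x} {y} {u} {v}
        ; *-assoc          = mul-assoc
        ; *-identity       = mul-identityˡ , λ x → ≈-trans (mul-comm x one) (mul-identityˡ x)
        ; distrib          = mul-distribˡ , λ x y z →
            ≈-trans (mul-comm _ x)
              (≈-trans (mul-distribˡ x y z) (AbelianGroup.∙-cong additiveGroup (mul-comm x y) (mul-comm x z)))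
        }
      ; *-comm = mul-comm
      }
    }
    where ≈-trans = AbelianGroup.trans additiveGroup

module ComplexNumbers {c ℓ} (ℝ : CompleteOrderedField c ℓ) where
  private
    module ℝ where
      open CompleteOrderedField ℝ public
      open IsStrictTotalOrder isStrictTotalOrder public using (_≟_)
      open RealProperties ℝ public

    open SemiringSolver ℝ.commutativeSemiring using (solve; _:=_; _:+_; _:*_)

  open ComplexRing ℝ public
  open CommutativeRing ℂ-commutativeRing public renaming (Carrier to ℂ; setoid to ℂₛ)
  open Exp semiring public using (_^_; ^-congˡ)
  open Mult semiring public using () renaming (_×_ to _×ᴺ_)

  _≉0 : ℂ → Set ℓ
  x ≉0 = ¬ x ≈ 0#

  _≟_ : Decidable _≈_
  _≟_ = ×-decidable ℝ._≟_ ℝ._≟_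

  fromℕ : ℕ → ℂ
  fromℕ n = n ×ᴺ 1#

  ∣_∣² : ℂ → ℝ.Carrier
  ∣ a , b ∣² = a ℝ.* a ℝ.+ b ℝ.* b

  -- ∣ z ∣< ε is used for positive ε only; there it says that the modulus,
  -- the square root of ∣ z ∣², is less than ε.
  ∣_∣<_ : ℂ → ℝ.Carrier → Set ℓ
  ∣ z ∣< ε = ∣ z ∣² ℝ.< ε ℝ.* ε

  infixl 7 _/_
  infix  9 _⁻¹

  -- Total, with 0# ⁻¹ ≈ 0#.
  _⁻¹ : ℂ → ℂ
  z@(a , b) ⁻¹ = a ℝ.* ℝ.inv ∣ z ∣² , ℝ.- b ℝ.* ℝ.inv ∣ z ∣²

  _/_ : ℂ → ℂ → ℂ
  x / y = x * y ⁻¹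

  ⁻¹-inverse : ∀ z → z ≉0 → z * z ⁻¹ ≈ 1#
  ⁻¹-inverse z@(a , b) z≉0 =
    ℝ.trans
      (begin
        a ℝ.* (a ℝ.* i) ℝ.- b ℝ.* (ℝ.- b ℝ.* i)
          ≈⟨ ℝ.+-congˡ (RingProperties.-‿distribʳ-* ℝ.ring b (ℝ.- b ℝ.* i)) ⟩
        a ℝ.* (a ℝ.* i) ℝ.+ b ℝ.* ℝ.- (ℝ.- b ℝ.* i)
          ≈⟨ ℝ.+-congˡ (ℝ.*-congˡ (RingProperties.-‿distribˡ-* ℝ.ring (ℝ.- b) i)) ⟩
        a ℝ.* (a ℝ.* i) ℝ.+ b ℝ.* (ℝ.- ℝ.- b ℝ.* i)
          ≈⟨ ℝ.+-congˡ (ℝ.*-congˡ (ℝ.*-congʳ (RingProperties.-‿involutive ℝ.ring b))) ⟩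
        a ℝ.* (a ℝ.* i) ℝ.+ b ℝ.* (b ℝ.* i)
          ≈⟨ solve 3 (λ a b i → a :* (a :* i) :+ b :* (b :* i) := (a :* a :+ b :* b) :* i)
               ℝ.refl a b i ⟩
        (a ℝ.* a ℝ.+ b ℝ.* b) ℝ.* i ∎)
      (ℝ.inv-inverse ∣ z ∣² (ℝ.sum-of-squares≉0 a b z≉0)) ,
    (begin
      a ℝ.* (ℝ.- b ℝ.* i) ℝ.+ b ℝ.* (a ℝ.* i)
        ≈⟨ solve 4 (λ a b b⁻ i → a :* (b⁻ :* i) :+ b :* (a :* i) := (a :* i) :* (b⁻ :+ b))
             ℝ.refl a b (ℝ.- b) i ⟩
      (a ℝ.* i) ℝ.* (ℝ.- b ℝ.+ b)
        ≈⟨ ℝ.*-congˡ (ℝ.-‿inverseˡ b) ⟩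
      (a ℝ.* i) ℝ.* ℝ.0#
        ≈⟨ ℝ.zeroʳ _ ⟩
      ℝ.0# ∎)
    where
    open SetoidReasoning ℝ.setoid
    i = ℝ.inv ∣ z ∣²

  ⁻¹-cong : ∀ {x y} → x ≈ y → x ⁻¹ ≈ y ⁻¹
  ⁻¹-cong (p , q) = ℝ.*-cong p inv≈ , ℝ.*-cong (ℝ.-‿cong q) inv≈
    where inv≈ = ℝ.inv-cong (ℝ.+-cong (ℝ.*-cong p p) (ℝ.*-cong q q))

  /-cong : ∀ {x y u v} → x ≈ y → u ≈ v → x / u ≈ y / v
  /-cong x≈y u≈v = *-cong x≈y (⁻¹-cong u≈v)

  fromℕ-suc≉0 : ∀ n → fromℕ (suc n) ≉0
  fromℕ-suc≉0 n eq = ℝ.suc×1≉0 n (ℝ.trans (ℝ.sym (re (suc n))) (proj₁ eq))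
    where
    re : ∀ m → proj₁ (fromℕ m) ℝ.≈ m ℝ.×ᴺ ℝ.1#
    re zero    = ℝ.refl
    re (suc m) = ℝ.+-congˡ (re m)

  -- ∑[1… n ] F is F 1 + … + F n.
  ∑[1…_] : ℕ → (ℕ → ℂ) → ℂ
  ∑[1… zero  ] F = 0#
  ∑[1… suc n ] F = ∑[1… n ] F + F (suc n)

  infix 4 _⟶_

  _⟶_ : (ℕ → ℂ) → ℂ → Set (c ⊔ ℓ)
  s ⟶ l = ∀ ε → ℝ.0# ℝ.< ε → ∃ λ N → ∀ n → N ℕ.≤ n → ∣ s n - l ∣< ε

  Converges : (ℕ → ℂ) → Set (c ⊔ ℓ)
  Converges s = ∃ λ l → s ⟶ l

  -- The limit as h → 0 over h ≠ 0.
  Limit₀ : (ℂ → ℂ) → ℂ → Set (c ⊔ ℓ)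
  Limit₀ F l =
    ∀ ε → ℝ.0# ℝ.< ε → ∃ λ δ → ℝ.0# ℝ.< δ × (∀ h → h ≉0 → ∣ h ∣< δ → ∣ F h - l ∣< ε)

  HasDerivativeAt : (ℂ → ℂ) → ℂ → ℂ → Set (c ⊔ ℓ)
  HasDerivativeAt F z d = Limit₀ (λ h → (F (z + h) - F z) / h) d

  Entire : (ℂ → ℂ) → Set (c ⊔ ℓ)
  Entire F = ∀ z → ∃ λ d → HasDerivativeAt F z d

  -- ζ s for an integer s > 1, as the value of its Dirichlet series.
  IsZetaValue : ℕ → ℂ → Set (c ⊔ ℓ)
  IsZetaValue s v = (λ N → ∑[1… N ] λ n → 1# / fromℕ n ^ s) ⟶ v

module Polynomials {c ℓ} (ℝ : CompleteOrderedField c ℓ) where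
  open ComplexNumbers ℝ
  open SetoidReasoning ℂₛ
  private
    open SemiringSolver commutativeSemiring using (solve; _:=_; _:+_; _:*_)

    m : ℂ
    m = - 1#

    neg : ∀ {x} → - x ≈ m * x
    neg {x} = sym (RingProperties.-1*x≈-x ring x)

  -- Coefficients, constant term first; trailing zeros are allowed.
  Poly : Set c
  Poly = List ℂ

  eval : Poly → ℂ → ℂ
  eval []      z = 0#
  eval (a ∷ p) z = a + z * eval p z

  coeff : Poly → ℕ → ℂ
  coeff []      _       = 0#
  coeff (a ∷ _) zero    = a
  coeff (_ ∷ p) (suc k) = coeff p k

  DegreeAtMost : ℕ → Poly → Set ℓ
  DegreeAtMost m p = ∀ k → m ℕ.< k → coeff p k ≈ 0#

  -- nothing stands for the degree -∞ of the null polynomial.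
  HasDegree : Maybe ℕ → Poly → Set ℓ
  HasDegree nothing  p = ∀ k → coeff p k ≈ 0#
  HasDegree (just d) p = coeff p d ≉0 × DegreeAtMost d p

  infixl 6 _⊞_
  _⊞_ : Poly → Poly → Poly
  []      ⊞ q       = q
  (a ∷ p) ⊞ []      = a ∷ p
  (a ∷ p) ⊞ (b ∷ q) = (a + b) ∷ (p ⊞ q)

  scale : ℂ → Poly → Poly
  scale c = map (c *_)

  -- (X + c) · p
  X+_·_ : ℂ → Poly → Poly
  X+ c · p = (0# ∷ p) ⊞ scale c p

  eval-⊞ : ∀ p q z → eval (p ⊞ q) z ≈ eval p z + eval q z
  eval-⊞ []      q       z = sym (+-identityˡ _)
  eval-⊞ (a ∷ p) []      z = sym (+-identityʳ _)
  eval-⊞ (a ∷ p) (b ∷ q) z = begin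
    (a + b) + z * eval (p ⊞ q) z
      ≈⟨ +-congˡ (*-congˡ (eval-⊞ p q z)) ⟩
    (a + b) + z * (eval p z + eval q z)
      ≈⟨ solve 5 (λ a b z p q → ((a :+ b) :+ z :* (p :+ q)) := ((a :+ z :* p) :+ (b :+ z :* q)))
           refl a b z (eval p z) (eval q z) ⟩
    (a + z * eval p z) + (b + z * eval q z) ∎

  eval-scale : ∀ c p z → eval (scale c p) z ≈ c * eval p z
  eval-scale c []      z = sym (zeroʳ c)
  eval-scale c (a ∷ p) z = begin
    c * a + z * eval (scale c p) z  ≈⟨ +-congˡ (*-congˡ (eval-scale c p z)) ⟩
    c * a + z * (c * eval p z)
      ≈⟨ solve 4 (λ c a z p → (c :* a :+ z :* (c :* p)) := (c :* (a :+ z :* p))) refl c a z (eval p z) ⟩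
    c * (a + z * eval p z)          ∎

  eval-X+ : ∀ c p z → eval (X+ c · p) z ≈ (z + c) * eval p z
  eval-X+ c p z = begin
    eval (X+ c · p) z                          ≈⟨ eval-⊞ (0# ∷ p) (scale c p) z ⟩
    (0# + z * eval p z) + eval (scale c p) z   ≈⟨ +-cong (+-identityˡ _) (eval-scale c p z) ⟩
    z * eval p z + c * eval p z                ≈⟨ distribʳ _ _ _ ⟨
    (z + c) * eval p z                         ∎

  translateᵖ : ℂ → Poly → Poly
  translateᵖ c []      = []
  translateᵖ c (a ∷ p) = (a ∷ []) ⊞ (X+ c · translateᵖ c p)

  eval-translateᵖ : ∀ c p z → eval (translateᵖ c p) z ≈ eval p (z + c)
  eval-translateᵖ c []      z = refl
  eval-translateᵖ c (a ∷ p) z = begin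
    eval ((a ∷ []) ⊞ (X+ c · translateᵖ c p)) z
      ≈⟨ eval-⊞ (a ∷ []) (X+ c · translateᵖ c p) z ⟩
    (a + z * 0#) + eval (X+ c · translateᵖ c p) z
      ≈⟨ +-cong (trans (+-congˡ (zeroʳ z)) (+-identityʳ a)) (eval-X+ c (translateᵖ c p) z) ⟩
    a + (z + c) * eval (translateᵖ c p) z
      ≈⟨ +-congˡ (*-congˡ (eval-translateᵖ c p z)) ⟩
    a + (z + c) * eval p (z + c) ∎

  -- An antidifference of p (see the record below) is found by expanding p in
  -- the rising factorials z(z+1)…(z+k-1), the k-th of which is the backward
  -- difference of z(z+1)…(z+k) / (k+1).
  private
    -- Rising-factorial expansions in nested form:
    -- evalᴿ k (b₀ ∷ b₁ ∷ …) z = b₀ + (z+k)(b₁ + (z+k+1)(b₂ + …)).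
    evalᴿ : ℕ → List ℂ → ℂ → ℂ
    evalᴿ k []       z = 0#
    evalᴿ k (b ∷ bs) z = b + (z + fromℕ k) * evalᴿ (suc k) bs z

    addHead : ℂ → List ℂ → List ℂ
    addHead b []        = b ∷ []
    addHead b (b′ ∷ bs) = (b + b′) ∷ bs

    evalᴿ-addHead : ∀ k b bs z → evalᴿ k (addHead b bs) z ≈ b + evalᴿ k bs z
    evalᴿ-addHead k b []        z = +-congˡ (zeroʳ _)
    evalᴿ-addHead k b (b′ ∷ bs) z = +-assoc _ _ _

    timesX : ℕ → List ℂ → List ℂ
    timesX k []       = []
    timesX k (b ∷ bs) = (- fromℕ k * b) ∷ addHead b (timesX (suc k) bs)

    evalᴿ-timesX : ∀ k bs z → evalᴿ k (timesX k bs) z ≈ z * evalᴿ k bs z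
    evalᴿ-timesX k []       z = sym (zeroʳ z)
    evalᴿ-timesX k (b ∷ bs) z = begin
      - n * b + (z + n) * evalᴿ (suc k) (addHead b (timesX (suc k) bs)) z
        ≈⟨ +-congˡ (*-congˡ (evalᴿ-addHead (suc k) b (timesX (suc k) bs) z)) ⟩
      - n * b + (z + n) * (b + evalᴿ (suc k) (timesX (suc k) bs) z)
        ≈⟨ +-congˡ (*-congˡ (+-congˡ (evalᴿ-timesX (suc k) bs z))) ⟩
      - n * b + (z + n) * (b + z * r)
        ≈⟨ solve 5 (λ n m b z r → (m :* b :+ (z :+ n) :* (b :+ z :* r))
                              := ((m :+ n) :* b :+ z :* (b :+ (z :+ n) :* r))) refl n (- n) b z r ⟩
      (- n + n) * b + z * (b + (z + n) * r)
        ≈⟨ +-congʳ (trans (*-congʳ (-‿inverseˡ n)) (zeroˡ b)) ⟩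
      0# + z * (b + (z + n) * r)
        ≈⟨ +-identityˡ _ ⟩
      z * (b + (z + n) * r) ∎
      where
      n = fromℕ k
      r = evalᴿ (suc k) bs z

    toRising : Poly → List ℂ
    toRising []      = []
    toRising (a ∷ p) = addHead a (timesX 0 (toRising p))

    evalᴿ-toRising : ∀ p z → evalᴿ 0 (toRising p) z ≈ eval p z
    evalᴿ-toRising []      z = refl
    evalᴿ-toRising (a ∷ p) z = begin
      evalᴿ 0 (addHead a (timesX 0 (toRising p))) z  ≈⟨ evalᴿ-addHead 0 a (timesX 0 (toRising p)) z ⟩
      a + evalᴿ 0 (timesX 0 (toRising p)) z          ≈⟨ +-congˡ (evalᴿ-timesX 0 (toRising p) z) ⟩
      a + z * evalᴿ 0 (toRising p) z                 ≈⟨ +-congˡ (*-congˡ (evalᴿ-toRising p z)) ⟩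
      a + z * eval p z                               ∎

    fromRising : ℕ → List ℂ → Poly
    fromRising k []       = []
    fromRising k (b ∷ bs) = (b ∷ []) ⊞ (X+ fromℕ k · fromRising (suc k) bs)

    eval-fromRising : ∀ k bs z → eval (fromRising k bs) z ≈ evalᴿ k bs z
    eval-fromRising k []       z = refl
    eval-fromRising k (b ∷ bs) z = begin
      eval ((b ∷ []) ⊞ (X+ fromℕ k · fromRising (suc k) bs)) z
        ≈⟨ eval-⊞ (b ∷ []) (X+ fromℕ k · fromRising (suc k) bs) z ⟩
      (b + z * 0#) + eval (X+ fromℕ k · fromRising (suc k) bs) z
        ≈⟨ +-cong (trans (+-congˡ (zeroʳ z)) (+-identityʳ b)) (eval-X+ (fromℕ k) (fromRising (suc k) bs) z) ⟩
      b + (z + fromℕ k) * eval (fromRising (suc k) bs) z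
        ≈⟨ +-congˡ (*-congˡ (eval-fromRising (suc k) bs z)) ⟩
      b + (z + fromℕ k) * evalᴿ (suc k) bs z ∎

    divide : ℕ → List ℂ → List ℂ
    divide k []       = []
    divide k (b ∷ bs) = b / fromℕ (suc k) ∷ divide (suc k) bs

    rising : ℕ → ℂ → ℂ
    rising zero    z = 1#
    rising (suc k) z = rising k z * (z + fromℕ k)

    z-1+suc : ∀ z k → (z - 1#) + fromℕ (suc k) ≈ z + fromℕ k
    z-1+suc z k = begin
      (z - 1#) + (1# + fromℕ k)
        ≈⟨ solve 4 (λ z m o n → ((z :+ m) :+ (o :+ n)) := ((m :+ o) :+ (z :+ n))) refl z (- 1#) 1# (fromℕ k) ⟩
      (- 1# + 1#) + (z + fromℕ k)  ≈⟨ +-congʳ (-‿inverseˡ 1#) ⟩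
      0# + (z + fromℕ k)           ≈⟨ +-identityˡ _ ⟩
      z + fromℕ k                  ∎

    rising-shift : ∀ k z → rising (suc k) (z - 1#) ≈ (z - 1#) * rising k z
    rising-shift zero    z = begin
      1# * ((z - 1#) + 0#)  ≈⟨ *-identityˡ _ ⟩
      (z - 1#) + 0#         ≈⟨ +-identityʳ _ ⟩
      z - 1#                ≈⟨ *-identityʳ _ ⟨
      (z - 1#) * 1#         ∎
    rising-shift (suc k) z = begin
      rising (suc k) (z - 1#) * ((z - 1#) + fromℕ (suc k))
        ≈⟨ *-cong (rising-shift k z) (z-1+suc z k) ⟩
      ((z - 1#) * rising k z) * (z + fromℕ k)
        ≈⟨ *-assoc _ _ _ ⟩
      (z - 1#) * rising (suc k) z ∎

    rising-difference : ∀ k b z →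
      rising (suc k) z * (b / fromℕ (suc k)) - rising (suc k) (z - 1#) * (b / fromℕ (suc k))
        ≈ rising k z * b
    rising-difference k b z = begin
      (r * (z + n)) * (b * i) - rising (suc k) (z - 1#) * (b * i)
        ≈⟨ +-congˡ (-‿cong (*-congʳ (rising-shift k z))) ⟩
      (r * (z + n)) * (b * i) - ((z - 1#) * r) * (b * i)
        ≈⟨ +-congʳ (*-congʳ (*-congˡ (z-1+suc z k))) ⟨
      (r * ((z - 1#) + s)) * (b * i) - ((z - 1#) * r) * (b * i)
        ≈⟨ solve 6 (λ r w s b i y → (r :* (w :+ s)) :* (b :* i) :+ y
                     := (r :* b) :* (s :* i) :+ ((w :* r) :* (b :* i) :+ y))
             refl r (z - 1#) s b i _ ⟩
      (r * b) * (s * i) + (((z - 1#) * r) * (b * i) - ((z - 1#) * r) * (b * i))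
        ≈⟨ +-cong (*-congˡ (⁻¹-inverse s (fromℕ-suc≉0 k))) (-‿inverseʳ _) ⟩
      (r * b) * 1# + 0#
        ≈⟨ trans (+-identityʳ _) (*-identityʳ _) ⟩
      r * b ∎
      where
      r = rising k z
      n = fromℕ k
      s = fromℕ (suc k)
      i = s ⁻¹

    divide-difference : ∀ k bs z →
      rising (suc k) z * evalᴿ (suc k) (divide k bs) z
        - rising (suc k) (z - 1#) * evalᴿ (suc k) (divide k bs) (z - 1#)
        ≈ rising k z * evalᴿ k bs z
    divide-difference k []       z = begin
      rising (suc k) z * 0# - rising (suc k) (z - 1#) * 0#  ≈⟨ +-cong (zeroʳ _) (-‿cong (zeroʳ _)) ⟩
      0# - 0#                                               ≈⟨ -‿inverseʳ 0# ⟩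
      0#                                                    ≈⟨ zeroʳ _ ⟨
      rising k z * 0#                                       ∎
    divide-difference k (b ∷ bs) z = begin
      u * (q + v * e) - u′ * (q + v′ * e′)
        ≈⟨ +-congˡ neg ⟩
      u * (q + v * e) + m * (u′ * (q + v′ * e′))
        ≈⟨ solve 8 (λ m u v e u′ v′ e′ q →
                     u :* (q :+ v :* e) :+ m :* (u′ :* (q :+ v′ :* e′))
                     := (u :* q :+ m :* (u′ :* q)) :+ ((u :* v) :* e :+ m :* ((u′ :* v′) :* e′)))
             refl m u v e u′ v′ e′ q ⟩
      (u * q + m * (u′ * q)) + ((u * v) * e + m * ((u′ * v′) * e′))
        ≈⟨ +-cong (+-congˡ neg) (+-congˡ neg) ⟨
      (u * q - u′ * q) + ((u * v) * e - (u′ * v′) * e′)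
        ≈⟨ +-cong (rising-difference k b z) (divide-difference (suc k) bs z) ⟩
      r * b + (r * (z + fromℕ k)) * t
        ≈⟨ +-congˡ (*-assoc _ _ _) ⟩
      r * b + r * ((z + fromℕ k) * t)
        ≈⟨ distribˡ _ _ _ ⟨
      r * (b + (z + fromℕ k) * t) ∎
      where
      r  = rising k z
      t  = evalᴿ (suc k) bs z
      q  = b / fromℕ (suc k)
      u  = rising (suc k) z
      u′ = rising (suc k) (z - 1#)
      v  = z + fromℕ (suc k)
      v′ = (z - 1#) + fromℕ (suc k)
      e  = evalᴿ (suc (suc k)) (divide (suc k) bs) z
      e′ = evalᴿ (suc (suc k)) (divide (suc k) bs) (z - 1#)

  -- These conditions determine P as a polynomial function: the difference of
  -- two solutions is a polynomial of period 1 that vanishes at 0.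
  record Antidifference (p : Poly) : Set (c ⊔ ℓ) where
    field
      P          : Poly
      difference : ∀ z → eval P z - eval P (z - 1#) ≈ eval p z
      vanishes   : eval P 0# ≈ 0#

  antidifference : ∀ p → Antidifference p
  antidifference p = record
    { P          = fromRising 0 (0# ∷ divide 0 bs)
    ; difference = λ z → begin
        eval (fromRising 0 (0# ∷ divide 0 bs)) z - eval (fromRising 0 (0# ∷ divide 0 bs)) (z - 1#)
          ≈⟨ +-cong (value z) (-‿cong (value (z - 1#))) ⟩
        rising 1 z * evalᴿ 1 (divide 0 bs) z - rising 1 (z - 1#) * evalᴿ 1 (divide 0 bs) (z - 1#)
          ≈⟨ divide-difference 0 bs z ⟩
        1# * evalᴿ 0 bs z
          ≈⟨ *-identityˡ _ ⟩
        evalᴿ 0 bs z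
          ≈⟨ evalᴿ-toRising p z ⟩
        eval p z ∎
    ; vanishes   = begin
        eval (fromRising 0 (0# ∷ divide 0 bs)) 0#  ≈⟨ value 0# ⟩
        (1# * (0# + 0#)) * evalᴿ 1 (divide 0 bs) 0#
          ≈⟨ *-congʳ (trans (*-identityˡ _) (+-identityˡ _)) ⟩
        0# * evalᴿ 1 (divide 0 bs) 0#              ≈⟨ zeroˡ _ ⟩
        0#                                         ∎
    }
    where
    bs = toRising p
    value : ∀ z → eval (fromRising 0 (0# ∷ divide 0 bs)) z ≈ rising 1 z * evalᴿ 1 (divide 0 bs) z
    value z = begin
      eval (fromRising 0 (0# ∷ divide 0 bs)) z  ≈⟨ eval-fromRising 0 (0# ∷ divide 0 bs) z ⟩
      0# + (z + 0#) * evalᴿ 1 (divide 0 bs) z   ≈⟨ +-identityˡ _ ⟩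
      (z + 0#) * evalᴿ 1 (divide 0 bs) z        ≈⟨ *-congʳ (*-identityˡ _) ⟨
      (1# * (z + 0#)) * evalᴿ 1 (divide 0 bs) z ∎

  polySum : Poly → ℂ → ℂ → ℂ
  polySum p x y = eval P y - eval P (x - 1#)
    where open Antidifference (antidifference p)

module FractionalSums {c ℓ} (ℝ : CompleteOrderedField c ℓ) where
  open ComplexNumbers ℝ public
  open Polynomials ℝ public
    using (Poly; eval; DegreeAtMost; HasDegree; translateᵖ; polySum)

  Fun : Set (c ⊔ ℓ)
  Fun = Func ℂₛ ℂₛ

  FunSet : ∀ u → Set (c ⊔ ℓ ⊔ lsuc u)
  FunSet u = Pred Fun u

  open FunctionEquality ℂₛ ℂₛ public using (_⇨_) renaming (_≈_ to _≗_)

  -- translate s f is the function t ↦ f (t + s).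
  translate : ℂ → Fun → Fun
  translate s f = record
    { to   = λ t → f ⟨$⟩ (t + s)
    ; cong = λ t≈t′ → Func.cong f (+-congʳ t≈t′)
    }

  combination : ℂ → Fun → ℂ → Fun → Fun
  combination a f b g = record
    { to   = λ t → a * (f ⟨$⟩ t) + b * (g ⟨$⟩ t)
    ; cong = λ t≈t′ → +-cong (*-congˡ (Func.cong f t≈t′)) (*-congˡ (Func.cong g t≈t′))
    }

  evalCombination : ∀ {u} {X : FunSet u} → List (ℂ × ∃ X) → ℂ → ℂ
  evalCombination []                  t = 0#
  evalCombination ((a , g , _) ∷ ags) t = a * (g ⟨$⟩ t) + evalCombination ags t

  L : ∀ {u} → FunSet u → FunSet (c ⊔ ℓ ⊔ u)
  L X f = Σ (List (ℂ × ∃ X)) λ ags → ∀ t → f ⟨$⟩ t ≈ evalCombination ags t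

  T : ∀ {u} → FunSet u → FunSet (c ⊔ ℓ ⊔ u)
  T X f = ∃ λ g → g ∈ X × (∃ λ s → f ≗ translate s g)

  S : ∀ {u} → FunSet u → FunSet (c ⊔ ℓ ⊔ u)
  S X = L (T X)

  S-combination : ∀ {u} {U : FunSet u} a b {f g} → f ∈ S U → g ∈ S U → combination a f b g ∈ S U
  S-combination {U = U} a b {f} {g} (fs , f≈) (gs , g≈) =
    scaleAll a fs ++ scaleAll b gs , λ t → begin
      a * (f ⟨$⟩ t) + b * (g ⟨$⟩ t)
        ≈⟨ +-cong (trans (*-congˡ (f≈ t)) (eval-scaleAll a fs t))
                  (trans (*-congˡ (g≈ t)) (eval-scaleAll b gs t)) ⟩
      evalCombination (scaleAll a fs) t + evalCombination (scaleAll b gs) t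
        ≈⟨ eval-++ (scaleAll a fs) (scaleAll b gs) t ⟨
      evalCombination (scaleAll a fs ++ scaleAll b gs) t ∎
    where
    open SetoidReasoning ℂₛ
    scaleAll : ℂ → List (ℂ × ∃ (T U)) → List (ℂ × ∃ (T U))
    scaleAll r = map λ (s , h) → r * s , h

    eval-scaleAll : ∀ r hs t → r * evalCombination hs t ≈ evalCombination (scaleAll r hs) t
    eval-scaleAll r []                 t = zeroʳ r
    eval-scaleAll r ((s , h , _) ∷ hs) t = begin
      r * (s * (h ⟨$⟩ t) + evalCombination hs t)
        ≈⟨ distribˡ _ _ _ ⟩
      r * (s * (h ⟨$⟩ t)) + r * evalCombination hs t
        ≈⟨ +-cong (sym (*-assoc _ _ _)) (eval-scaleAll r hs t) ⟩
      (r * s) * (h ⟨$⟩ t) + evalCombination (scaleAll r hs) t ∎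

    eval-++ : ∀ (hs ks : List (ℂ × ∃ (T U))) t →
      evalCombination (hs ++ ks) t ≈ evalCombination hs t + evalCombination ks t
    eval-++ []       ks t = sym (+-identityˡ _)
    eval-++ (_ ∷ hs) ks t = trans (+-congˡ (eval-++ hs ks t)) (sym (+-assoc _ _ _))

  S-translate : ∀ {u} {U : FunSet u} s {f} → f ∈ S U → translate s f ∈ S U
  S-translate {U = U} s (fs , f≈) =
    translateAll fs , λ t → trans (f≈ (t + s)) (eval-translateAll fs t)
    where
    translateAll : List (ℂ × ∃ (T U)) → List (ℂ × ∃ (T U))
    translateAll = map λ (a , h , g , g∈U , r , h≗) →
      a , translate s h , g , g∈U , s + r ,
      λ t → trans (h≗ (t + s)) (Func.cong g (+-assoc t s r))

    eval-translateAll : ∀ hs t → evalCombination hs (t + s) ≈ evalCombination (translateAll hs) t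
    eval-translateAll []       t = refl
    eval-translateAll (_ ∷ hs) t = +-congˡ (eval-translateAll hs t)

  FractionalSummable : FunSet (c ⊔ ℓ)
  FractionalSummable f =
    ∃ λ m → Σ (ℕ → Poly) λ p →
      (∀ n → DegreeAtMost m (p n)) ×
      (∀ x → (λ n → (f ⟨$⟩ (fromℕ n + x)) - eval (p n) (fromℕ n + x)) ⟶ 0#) ×
      (∀ x y → Converges λ n →
        polySum (p n) (fromℕ n + x) (fromℕ n + y)
          + ∑[1… n ] λ ν → (f ⟨$⟩ (fromℕ ν + x - 1#)) - (f ⟨$⟩ (fromℕ ν + y)))

  𝓕 : FunSet (c ⊔ ℓ)
  𝓕 = L ((λ f → Entire (f ⟨$⟩_)) ∪ FractionalSummable)

  S-setoid : ∀ {u} → FunSet u → Setoid (c ⊔ ℓ ⊔ u) (c ⊔ ℓ)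
  S-setoid U = On.setoid {B = ∃ (S U)} _⇨_ proj₁

  -- Extensional maps S(U) × ℂ² → ℂ.
  SumMap : ∀ {u} → FunSet u → Set (c ⊔ ℓ ⊔ u)
  SumMap U = Func (S-setoid U ×ₛ (ℂₛ ×ₛ ℂₛ)) ℂₛ

  record SatisfiesAxioms {u} (U : FunSet u) (σ : SumMap U) : Set (c ⊔ ℓ ⊔ u) where
    private
      Σ[_] : ∃ (S U) → ℂ → ℂ → ℂ
      Σ[ f ] x y = σ ⟨$⟩ (f , x , y)

      shift : ℂ → ∃ (S U) → ∃ (S U)
      shift s (f , f∈S) = translate s f , S-translate s {f} f∈S

      combine : ℂ → ∃ (S U) → ℂ → ∃ (S U) → ∃ (S U)
      combine a (f , f∈S) b (g , g∈S) =
        combination a f b g , S-combination a b {f} {g} f∈S g∈S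

      infix 20 _·_
      _·_ : ∃ (S U) → ℂ → ℂ
      (f , _) · t = f ⟨$⟩ t

    field
      continuedSummation : ∀ f x y z → Σ[ f ] x y + Σ[ f ] (y + 1#) z ≈ Σ[ f ] x z
      translationInvariance : ∀ f x y s → Σ[ f ] (x + s) (y + s) ≈ Σ[ shift s f ] x y
      linearity : ∀ a b f g x y →
        Σ[ combine a f b g ] x y ≈ a * Σ[ f ] x y + b * Σ[ g ] x y
      consistency : ∀ f → Σ[ f ] 1# 1# ≈ f · 1#
      holomorphy : ∀ f → Entire (f ·_) → Entire (λ x → Σ[ f ] 1# x)
      nullShiftRegularity : ∀ f →
        (∀ t → (λ n → f · (t + fromℕ n)) ⟶ 0#) →
        ∀ x y → (λ n → Σ[ shift (fromℕ n) f ] x y) ⟶ 0#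
      polynomialShiftRegularity : ∀ f d (p : ℕ → Poly) →
        (∀ n → HasDegree d (p n)) →
        (∀ t → (λ n → f · (t + fromℕ n) - eval (p n) (t + fromℕ n)) ⟶ 0#) →
        ∀ x y →
        (λ n → Σ[ shift (fromℕ n) f ] x y - polySum (translateᵖ (fromℕ n) (p n)) x y) ⟶ 0#

  record SummableSet {u} (U : FunSet u) : Set (c ⊔ ℓ ⊔ u) where
    field
      U⊆𝓕        : U ⊆ 𝓕
      sumMap     : SumMap U
      axioms     : SatisfiesAxioms U sumMap
      uniqueness : ∀ σ → SatisfiesAxioms U σ → ∀ fxy → σ ⟨$⟩ fxy ≈ sumMap ⟨$⟩ fxy

    sum : ∀ f → f ∈ S U → ℂ → ℂ → ℂ
    sum f f∈S x y = sumMap ⟨$⟩ ((f , f∈S) , x , y)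

    IsEssence : ∀ f → f ∈ S U → ℂ → Set (c ⊔ ℓ)
    IsEssence f f∈S e = Limit₀ (λ h → 1# / h * sum f f∈S 1# h) e

  -- x ↦ g x for x ≠ 0, and 0 ↦ 0.
  punctured : (g : ℂ → ℂ) → (∀ {x y} → x ≈ y → g x ≈ g y) → Fun
  punctured g g-cong = record { to = to ; cong = to-cong }
    where
    to : ℂ → ℂ
    to x with x ≟ 0#
    ... | yes _ = 0#
    ... | no  _ = g x

    to-cong : ∀ {x y} → x ≈ y → to x ≈ to y
    to-cong {x} {y} x≈y with x ≟ 0# | y ≟ 0#
    ... | yes _   | yes _   = refl
    ... | yes x≈0 | no y≉0  = contradiction (trans (sym x≈y) x≈0) y≉0
    ... | no x≉0  | yes y≈0 = contradiction (trans x≈y y≈0) x≉0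
    ... | no _    | no _    = g-cong x≈y

  invPow : ℕ → Fun
  invPow a = punctured (λ x → 1# / x ^ a) (λ x≈y → /-cong (refl {1#}) (^-congˡ a x≈y))

  invPow′ : ℕ → Fun
  invPow′ a = punctured (λ x → - (fromℕ a / x ^ suc a))
    (λ x≈y → -‿cong (/-cong refl (^-congˡ (suc a) x≈y)))

  NegativeInteger : Pred ℂ ℓ
  NegativeInteger x = ∃ λ n → x ≈ - fromℕ (suc n)

{-# OPTIONS --safe #-}

-- The axioms give Σ(f;1,x) = ∑_{ν≤n} (f(ν) - f(x+ν)) + Σ(f(·+n);1,x), and the
-- last term tends to 0 for f = f_a and f = f_a′.  Hence the difference quotient
-- of x ↦ Σ(f_a;1,x) is the sum over ν of the difference quotients of -f_a(x+ν).
-- With i = 1/(x+ν) and j = 1/(x+h+ν), the quotient (iᵃ - jᵃ)/h differs from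
-- a iᵃ⁺¹ by h times a polynomial in i and j, which is O(1/ν²) uniformly for h
-- near 0 because |i| and |j| are O(1/ν).  So the derivative at x is
-- ∑ a/(x+ν)ᵃ⁺¹; at x = 0 this is the essence a ζ(a+1), and for general x it
-- equals the essence plus Σ(f_a′;1,x).

module Submission where

import Algebra.Properties.CommutativeSemigroup as CommutativeSemigroupProperties
import Algebra.Properties.Ring as RingProperties
import Algebra.Properties.Semiring.Exp as Exp
import Algebra.Properties.Semiring.Mult as Mult
import Algebra.Properties.Semiring.Mult.TCOptimised as OptimisedMult
import Algebra.Solver.Ring as RingSolver
open import Algebra.Bundles using (CommutativeRing)
open import Algebra.Solver.Ring.AlmostCommutativeRing
  using (fromCommutativeRing; _-Raw-AlmostCommutative⟶_)
open import Data.Integer.Base as ℤ using (ℤ; +_; -[1+_])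
import Data.Integer.Properties as ℤ
open import Data.Maybe.Base as Maybe using (Maybe)
open import Data.Nat.Base as ℕ using (ℕ; zero; suc)
import Data.Nat.Properties as ℕ
open import Data.Product.Base using (∃; _,_; _×_; proj₁; proj₂)
open import Data.Sum.Base as Sum using (_⊎_; inj₁; inj₂)
open import Data.Unit.Base using (⊤; tt)
open import Function.Bundles using (Func; _⟨$⟩_)
open import Level using (_⊔_)
open import Relation.Binary.Bundles using (StrictTotalOrder)
import Relation.Binary.Construct.StrictToNonStrict as StrictToNonStrict
open import Relation.Binary.Definitions using (tri<; tri≈; tri>)
import Relation.Binary.Properties.StrictTotalOrder as StrictTotalOrderProperties
open import Relation.Binary.PropositionalEquality.Core as ≡ using (_≡_)
import Relation.Binary.Reasoning.Setoid as SetoidReasoning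
import Relation.Binary.Reasoning.StrictPartialOrder as StrictReasoning
open import Relation.Nullary using (¬_; yes; no; contradiction)
open import Relation.Nullary.Decidable using (dec⇒maybe)
open import Relation.Unary using (_∈_; _∉_)
open import Defs using
  (CompleteOrderedField; module RealProperties; module ComplexNumbers; module FractionalSums)

-- Differentiating the sum term by term exchanges the limit h → 0 with an infinite sum. The exchange
-- rests on an explicit estimate: the error of the ν-th quotient is h times a polynomial in i and j
-- all of whose monomials contain at least two factors i or j. For |h| < δ every partial sum of the
-- errors is therefore at most δ times one constant, and this survives n → ∞ up to an arbitrarily
-- small slack. The obstacle is to find a single C with |1/(x+h+ν)| ≤ C/ν for all ν ≥ 1 and all
-- small h. For large ν it follows from the boundedness of x + h; for each of the finitely many
-- other ν it follows from x + ν ≠ 0, and the radius for h shrinks accordingly. Convergence of ∑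
-- a/(x+ν)^(a+1) is derived from completeness at x = 0, where it is the series of ζ(a+1). At other x
-- it is inherited, because the partial sums differ from those at 0 by the partial sums of
-- Σ(f_a′;1,x), whose limit the axioms provide.

-- Ring normalisation with integer coefficients

module IntegerCoefficients {c ℓ} (R : CommutativeRing c ℓ) where
  open CommutativeRing R
  open RingProperties ring
  open CommutativeSemigroupProperties +-commutativeSemigroup using (interchange)
  -- With these multiples `1 ×ᴺ 1#` reduces to `1#`, so `1-homo` is `refl` and the constant
  -- `con (+ 1)` denotes `1#` itself.
  open OptimisedMult semiring using (×-homo-+; ×1-homo-*; 1+×) renaming (_×_ to _×ᴺ_)
  open SetoidReasoning setoid

  fromℤ : ℤ → Carrier
  fromℤ (+ n)    = n ×ᴺ 1#
  fromℤ -[1+ n ] = - (suc n ×ᴺ 1#)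

  fromℤ-⊖ : ∀ m n → fromℤ (m ℤ.⊖ n) ≈ m ×ᴺ 1# - n ×ᴺ 1#
  fromℤ-⊖ m       zero    = sym (trans (+-congˡ -0#≈0#) (+-identityʳ _))
  fromℤ-⊖ zero    (suc n) = sym (+-identityˡ _)
  fromℤ-⊖ (suc m) (suc n) = begin
    fromℤ (suc m ℤ.⊖ suc n)               ≡⟨ ≡.cong fromℤ (ℤ.[1+m]⊖[1+n]≡m⊖n m n) ⟩
    fromℤ (m ℤ.⊖ n)                       ≈⟨ fromℤ-⊖ m n ⟩
    m ×ᴺ 1# - n ×ᴺ 1#                       ≈⟨ +-identityˡ _ ⟨
    0# + (m ×ᴺ 1# - n ×ᴺ 1#)                ≈⟨ +-congʳ (-‿inverseʳ 1#) ⟨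
    (1# - 1#) + (m ×ᴺ 1# - n ×ᴺ 1#)         ≈⟨ interchange _ _ _ _ ⟩
    (1# + m ×ᴺ 1#) + (- 1# + - (n ×ᴺ 1#))   ≈⟨ +-congˡ (-‿+-comm _ _) ⟩
    (1# + m ×ᴺ 1#) - (1# + n ×ᴺ 1#)         ≈⟨ +-cong (1+× m 1#) (-‿cong (1+× n 1#)) ⟨
    suc m ×ᴺ 1# - suc n ×ᴺ 1#               ∎

  fromℤ-neg : ∀ i → fromℤ (ℤ.- i) ≈ - fromℤ i
  fromℤ-neg (+ zero)  = sym -0#≈0#
  fromℤ-neg (+ suc n) = refl
  fromℤ-neg -[1+ n ]  = sym (-‿involutive _)

  fromℤ-+ : ∀ i j → fromℤ (i ℤ.+ j) ≈ fromℤ i + fromℤ j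
  fromℤ-+ (+ m)    (+ n)    = ×-homo-+ 1# m n
  fromℤ-+ (+ m)    -[1+ n ] = fromℤ-⊖ m (suc n)
  fromℤ-+ -[1+ m ] (+ n)    = trans (fromℤ-⊖ n (suc m)) (+-comm _ _)
  fromℤ-+ -[1+ m ] -[1+ n ] = begin
    - (suc (suc (m ℕ.+ n)) ×ᴺ 1#)     ≡⟨ ≡.cong (λ k → - (suc k ×ᴺ 1#)) (ℕ.+-suc m n) ⟨
    - ((suc m ℕ.+ suc n) ×ᴺ 1#)       ≈⟨ -‿cong (×-homo-+ 1# (suc m) (suc n)) ⟩
    - (suc m ×ᴺ 1# + suc n ×ᴺ 1#)      ≈⟨ -‿+-comm _ _ ⟨
    - (suc m ×ᴺ 1#) - (suc n ×ᴺ 1#)    ∎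

  fromℤ-*⁺⁺ : ∀ m n → fromℤ (+ m ℤ.* + n) ≈ fromℤ (+ m) * fromℤ (+ n)
  fromℤ-*⁺⁺ m n = trans (reflexive (≡.cong fromℤ (≡.sym (ℤ.pos-* m n)))) (×1-homo-* m n)

  fromℤ-*⁺ : ∀ m j → fromℤ (+ m ℤ.* j) ≈ fromℤ (+ m) * fromℤ j
  fromℤ-*⁺ m (+ n)    = fromℤ-*⁺⁺ m n
  fromℤ-*⁺ m -[1+ n ] = begin
    fromℤ (+ m ℤ.* ℤ.- (+ suc n))  ≡⟨ ≡.cong fromℤ (ℤ.neg-distribʳ-* (+ m) (+ suc n)) ⟨
    fromℤ (ℤ.- (+ m ℤ.* + suc n))  ≈⟨ fromℤ-neg (+ m ℤ.* + suc n) ⟩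
    - fromℤ (+ m ℤ.* + suc n)      ≈⟨ -‿cong (fromℤ-*⁺⁺ m (suc n)) ⟩
    - (m ×ᴺ 1# * suc n ×ᴺ 1#)        ≈⟨ -‿distribʳ-* _ _ ⟩
    m ×ᴺ 1# * - (suc n ×ᴺ 1#)        ∎

  fromℤ-* : ∀ i j → fromℤ (i ℤ.* j) ≈ fromℤ i * fromℤ j
  fromℤ-* (+ m)    j = fromℤ-*⁺ m j
  fromℤ-* -[1+ m ] j = begin
    fromℤ (ℤ.- (+ suc m) ℤ.* j)    ≡⟨ ≡.cong fromℤ (ℤ.neg-distribˡ-* (+ suc m) j) ⟨
    fromℤ (ℤ.- (+ suc m ℤ.* j))    ≈⟨ fromℤ-neg (+ suc m ℤ.* j) ⟩
    - fromℤ (+ suc m ℤ.* j)        ≈⟨ -‿cong (fromℤ-*⁺ (suc m) j) ⟩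
    - (suc m ×ᴺ 1# * fromℤ j)       ≈⟨ -‿distribˡ-* _ _ ⟩
    - (suc m ×ᴺ 1#) * fromℤ j       ∎

  fromℤ-homomorphism : ℤ.+-*-rawRing -Raw-AlmostCommutative⟶ fromCommutativeRing R
  fromℤ-homomorphism = record
    { ⟦_⟧    = fromℤ
    ; +-homo = fromℤ-+
    ; *-homo = fromℤ-*
    ; -‿homo = fromℤ-neg
    ; 0-homo = refl
    ; 1-homo = refl
    }

  fromℤ-≟ : ∀ i j → Maybe (fromℤ i ≈ fromℤ j)
  fromℤ-≟ i j = Maybe.map (λ i≡j → reflexive (≡.cong fromℤ i≡j)) (dec⇒maybe (i ℤ.≟ j))

  open RingSolver ℤ.+-*-rawRing (fromCommutativeRing R) fromℤ-homomorphism fromℤ-≟ public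
    using (solve; _:=_; _:+_; _:*_; _:-_; :-_; con)

-- Inequalities in the real field and the sequence 1/(n+1)

module OrderedField {c ℓ} (ℝ : CompleteOrderedField c ℓ) where
  open CompleteOrderedField ℝ public
  open RealProperties ℝ public
  open IntegerCoefficients commutativeRing public
    using (solve; _:=_; _:+_; _:*_; _:-_; :-_; con)

  strictTotalOrder : StrictTotalOrder c ℓ ℓ
  strictTotalOrder = record { isStrictTotalOrder = isStrictTotalOrder }

  open StrictTotalOrder strictTotalOrder public
    using (compare; _≟_; irrefl; <-respʳ-≈; <-respˡ-≈; strictPartialOrder)
  open StrictToNonStrict _≈_ _<_ public using (_≤_; <⇒≤)
  open StrictTotalOrderProperties strictTotalOrder public
    using () renaming (total to ≤-total; trans to ≤-trans; refl to ≤-refl; reflexive to ≤-reflexive)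
  open StrictReasoning strictPartialOrder

  <-≤-trans : ∀ {x y z} → x < y → y ≤ z → x < z
  <-≤-trans {x} {y} {z} x<y y≤z = begin-strict x <⟨ x<y ⟩ y ≤⟨ y≤z ⟩ z ∎

  ≤-<-trans : ∀ {x y z} → x ≤ y → y < z → x < z
  ≤-<-trans {x} {y} {z} x≤y y<z = begin-strict x ≤⟨ x≤y ⟩ y <⟨ y<z ⟩ z ∎

  ≮⇒≥ : ∀ {x y} → ¬ x < y → y ≤ x
  ≮⇒≥ {x} {y} x≮y with compare x y
  ... | tri< x<y _ _ = contradiction x<y x≮y
  ... | tri≈ _ x≈y _ = inj₂ (sym x≈y)
  ... | tri> _ _ y<x = inj₁ y<x

  ≤⇒≯ : ∀ {x y} → x ≤ y → ¬ y < x
  ≤⇒≯ x≤y y<x = irrefl refl (≤-<-trans x≤y y<x)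

  x+positive : ∀ {x y z} → 0# < z → y ≈ x + z → x < y
  x+positive {x} 0<z y≈x+z =
    <-respˡ-≈ (+-identityʳ x) (<-respʳ-≈ (sym y≈x+z) (+-monoʳ-< x 0<z))

  x+nonneg : ∀ {x y z} → 0# ≤ z → y ≈ x + z → x ≤ y
  x+nonneg (inj₁ 0<z) y≈x+z = inj₁ (x+positive 0<z y≈x+z)
  x+nonneg {x} (inj₂ 0≈z) y≈x+z =
    inj₂ (trans (sym (+-identityʳ x)) (trans (+-congˡ 0≈z) (sym y≈x+z)))

  0<y-x : ∀ {x y} → x < y → 0# < y - x
  0<y-x {x} {y} x<y =
    <-respˡ-≈ (-‿inverseˡ x) (<-respʳ-≈ (+-comm (- x) y) (+-monoʳ-< (- x) x<y))

  0≤y-x : ∀ {x y} → x ≤ y → 0# ≤ y - x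
  0≤y-x (inj₁ x<y)     = inj₁ (0<y-x x<y)
  0≤y-x {x} (inj₂ x≈y) = inj₂ (trans (sym (-‿inverseʳ x)) (+-congʳ x≈y))

  +-monoˡ-< : ∀ {x y} z → x < y → x + z < y + z
  +-monoˡ-< {x} {y} z x<y =
    x+positive (0<y-x x<y) (solve 3 (λ x y z → y :+ z := (x :+ z) :+ (y :- x)) refl x y z)

  +-mono-≤ : ∀ {x y u v} → x ≤ y → u ≤ v → x + u ≤ y + v
  +-mono-≤ {x} {y} {u} {v} x≤y u≤v = begin
    x + u ≤⟨ x+nonneg (0≤y-x x≤y) (solve 3 (λ x y z → y :+ z := (x :+ z) :+ (y :- x)) refl x y u) ⟩
    y + u ≤⟨ x+nonneg (0≤y-x u≤v) (solve 3 (λ x y z → z :+ y := (z :+ x) :+ (y :- x)) refl u v y) ⟩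
    y + v ∎

  +-mono-<-≤ : ∀ {x y u v} → x < y → u ≤ v → x + u < y + v
  +-mono-<-≤ {u = u} x<y u≤v = <-≤-trans (+-monoˡ-< u x<y) (+-mono-≤ ≤-refl u≤v)

  +-nonneg : ∀ {x y} → 0# ≤ x → 0# ≤ y → 0# ≤ x + y
  +-nonneg 0≤x 0≤y = ≤-trans 0≤x (x+nonneg 0≤y refl)

  *-nonneg : ∀ {x y} → 0# ≤ x → 0# ≤ y → 0# ≤ x * y
  *-nonneg (inj₁ 0<x) (inj₁ 0<y) = inj₁ (*-positive 0<x 0<y)
  *-nonneg {x} _ (inj₂ 0≈y)      = inj₂ (trans (sym (zeroʳ x)) (*-congˡ 0≈y))
  *-nonneg {_} {y} (inj₂ 0≈x) _  = inj₂ (trans (sym (zeroˡ y)) (*-congʳ 0≈x))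

  square-nonneg : ∀ x → 0# ≤ x * x
  square-nonneg x with x ≟ 0#
  ... | yes x≈0 = inj₂ (trans (sym (zeroˡ x)) (*-congʳ (sym x≈0)))
  ... | no  x≉0 = inj₁ (square-positive x≉0)

  *-monoʳ-≤ : ∀ {x y z} → 0# ≤ z → x ≤ y → z * x ≤ z * y
  *-monoʳ-≤ {x} {y} {z} 0≤z x≤y = x+nonneg (*-nonneg 0≤z (0≤y-x x≤y))
    (solve 3 (λ x y z → z :* y := z :* x :+ z :* (y :- x)) refl x y z)

  *-monoʳ-< : ∀ {x y z} → 0# < z → x < y → z * x < z * y
  *-monoʳ-< {x} {y} {z} 0<z x<y = x+positive (*-positive 0<z (0<y-x x<y))
    (solve 3 (λ x y z → z :* y := z :* x :+ z :* (y :- x)) refl x y z)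

  *-mono-≤ : ∀ {x y u v} → 0# ≤ x → 0# ≤ v → x ≤ y → u ≤ v → x * u ≤ y * v
  *-mono-≤ {x} {y} {u} {v} 0≤x 0≤v x≤y u≤v = begin
    x * u  ≤⟨ *-monoʳ-≤ 0≤x u≤v ⟩
    x * v  ≈⟨ *-comm x v ⟩
    v * x  ≤⟨ *-monoʳ-≤ 0≤v x≤y ⟩
    v * y  ≈⟨ *-comm v y ⟩
    y * v  ∎

  square-mono-≤ : ∀ {x y} → 0# ≤ x → x ≤ y → x * x ≤ y * y
  square-mono-≤ 0≤x x≤y = *-mono-≤ 0≤x (≤-trans 0≤x x≤y) x≤y x≤y

  square-mono-< : ∀ {x y} → 0# ≤ x → x < y → x * x < y * y
  square-mono-< {x} {y} 0≤x x<y = begin-strict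
    x * x  ≤⟨ *-monoʳ-≤ 0≤x (<⇒≤ x<y) ⟩
    x * y  ≈⟨ *-comm x y ⟩
    y * x  <⟨ *-monoʳ-< (≤-<-trans 0≤x x<y) x<y ⟩
    y * y  ∎

  -- This does the work of a square root: moduli are known only through their squares.
  square-cancel-≤ : ∀ {x y} → 0# ≤ y → x * x ≤ y * y → x ≤ y
  square-cancel-≤ 0≤y xx≤yy = ≮⇒≥ λ y<x → ≤⇒≯ xx≤yy (square-mono-< 0≤y y<x)

  0<1 : 0# < 1#
  0<1 = <-respʳ-≈ (*-identityˡ 1#) (square-positive 1≉0)

  inv-positive : ∀ {x} → 0# < x → 0# < inv x
  inv-positive {x} 0<x with compare 0# (inv x)
  ... | tri< 0<i _ _ = 0<i
  ... | tri≈ _ 0≈i _ = contradiction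
    (trans (sym (inv-inverse x (positive⇒≉0 0<x))) (trans (*-congˡ (sym 0≈i)) (zeroʳ x))) 1≉0
  ... | tri> _ _ i<0 = contradiction
    (begin-strict
      1#         ≈⟨ inv-inverse x (positive⇒≉0 0<x) ⟨
      x * inv x  <⟨ *-monoʳ-< 0<x i<0 ⟩
      x * 0#     ≈⟨ zeroʳ x ⟩
      0#         ∎)
    (≤⇒≯ (<⇒≤ 0<1))

  *-cancelˡ-≤ : ∀ {x y z} → 0# < z → z * x ≤ z * y → x ≤ y
  *-cancelˡ-≤ 0<z zx≤zy = ≮⇒≥ λ y<x → ≤⇒≯ zx≤zy (*-monoʳ-< 0<z y<x)

  x*invx*y≈y : ∀ {x} y → 0# < x → x * inv x * y ≈ y
  x*invx*y≈y y 0<x = trans (*-congʳ (inv-inverse _ (positive⇒≉0 0<x))) (*-identityˡ y)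

  abstract
    half : Carrier → Carrier
    half x = x * inv (1# + 1#)

    half-positive : ∀ {x} → 0# < x → 0# < half x
    half-positive 0<x = *-positive 0<x (inv-positive (+-positive 0<1 0<1))

    half+half : ∀ x → half x + half x ≈ x
    half+half x = trans
      (solve 2 (λ x i → x :* i :+ x :* i := (con (+ 1) :+ con (+ 1)) :* i :* x)
        refl x (inv (1# + 1#)))
      (x*invx*y≈y x (+-positive 0<1 0<1))

  half< : ∀ {x} → 0# < x → half x < x
  half< {x} 0<x = x+positive (half-positive 0<x) (sym (half+half x))

  common-positive-bound : ∀ {x y} → 0# < x → 0# < y → ∃ λ z → 0# < z × z ≤ x × z ≤ y
  common-positive-bound {x} {y} 0<x 0<y with ≤-total x y
  ... | inj₁ x≤y = x , 0<x , ≤-refl , x≤y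
  ... | inj₂ y≤x = y , 0<y , y≤x , ≤-refl

  ×1-nonneg : ∀ n → 0# ≤ n ×ᴺ 1#
  ×1-nonneg zero    = ≤-refl
  ×1-nonneg (suc n) = +-nonneg (<⇒≤ 0<1) (×1-nonneg n)

  0<suc×1 : ∀ n → 0# < suc n ×ᴺ 1#
  0<suc×1 n = <-≤-trans 0<1 (x+nonneg (×1-nonneg n) refl)

  ×1-mono-≤ : ∀ {m n} → m ℕ.≤ n → m ×ᴺ 1# ≤ n ×ᴺ 1#
  ×1-mono-≤ {n = n} ℕ.z≤n = ×1-nonneg n
  ×1-mono-≤ (ℕ.s≤s m≤n)   = +-mono-≤ ≤-refl (×1-mono-≤ m≤n)

  abstract
    -- The summation index is ν = n + 1, so that `1/suc n` is 1/ν and ν = 0 never occurs.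
    1/suc : ℕ → Carrier
    1/suc n = inv (suc n ×ᴺ 1#)

    1/suc-inverse : ∀ n → suc n ×ᴺ 1# * 1/suc n ≈ 1#
    1/suc-inverse n = inv-inverse _ (suc×1≉0 n)

    1/suc-positive : ∀ n → 0# < 1/suc n
    1/suc-positive n = inv-positive (0<suc×1 n)

  -- The telescoping identity 1/(n+1) - 1/(n+2) = 1/((n+1)(n+2)), arranged without subtraction.
  1/suc-difference : ∀ n → 1/suc n ≈ 1/suc (suc n) + 1/suc n * 1/suc (suc n)
  1/suc-difference n = begin-equality
    q                                   ≈⟨ *-identityʳ q ⟨
    q * 1#                              ≈⟨ *-congˡ (1/suc-inverse (suc n)) ⟨
    q * ((1# + m) * q′)                 ≈⟨ solve 3 (λ q m q′ → q :* ((con (+ 1) :+ m) :* q′)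
                                             := (m :* q) :* q′ :+ q :* q′) refl q m q′ ⟩
    (m * q) * q′ + q * q′               ≈⟨ +-congʳ (trans (*-congʳ (1/suc-inverse n)) (*-identityˡ q′)) ⟩
    q′ + q * q′                         ∎
    where
    q  = 1/suc n
    q′ = 1/suc (suc n)
    m  = suc n ×ᴺ 1#

  1/suc-antitone : ∀ n → 1/suc (suc n) ≤ 1/suc n
  1/suc-antitone n =
    x+nonneg (*-nonneg (<⇒≤ (1/suc-positive n)) (<⇒≤ (1/suc-positive (suc n)))) (1/suc-difference n)

  1/suc≤1 : ∀ n → 1/suc n ≤ 1#
  1/suc≤1 n = *-cancelˡ-≤ (0<suc×1 n) (begin
    suc n ×ᴺ 1# * 1/suc n  ≈⟨ 1/suc-inverse n ⟩
    1#                     ≤⟨ x+nonneg (×1-nonneg n) refl ⟩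
    suc n ×ᴺ 1#            ≈⟨ *-identityʳ _ ⟨
    suc n ×ᴺ 1# * 1#       ∎)

  -- With ν = n + 2 this is 1/ν² ≤ 1/(ν-1) - 1/ν, the comparison that makes every series below
  -- converge; it follows from the telescoping identity by enlarging one factor 1/ν to 1/(ν-1).
  square-1/suc : ∀ n → 1/suc (suc n) * 1/suc (suc n) + 1/suc (suc n) ≤ 1/suc n
  square-1/suc n = begin
    q′ * q′ + q′  ≤⟨ +-mono-≤ (*-mono-≤ 0≤q′ 0≤q′ (1/suc-antitone n) ≤-refl) ≤-refl ⟩
    q * q′ + q′   ≈⟨ +-comm _ _ ⟩
    q′ + q * q′   ≈⟨ 1/suc-difference n ⟨
    q             ∎
    where
    q  = 1/suc n
    q′ = 1/suc (suc n)
    0≤q′ = <⇒≤ (1/suc-positive (suc n))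

  abstract
    1/suc-small : ∀ K ε → 0# ≤ K → 0# < ε → ∃ λ N → ∀ n → N ℕ.≤ n → K * 1/suc n < ε
    -- N exceeds K/ε, hence so does n + 1 for every n ≥ N.
    1/suc-small K ε 0≤K 0<ε with archimedean (K * inv ε)
    ... | N , K/ε<N = N , λ n N≤n → begin-strict
      K * 1/suc n                   ≈⟨ *-congʳ (x*invx*y≈y K 0<ε) ⟨
      ε * inv ε * K * 1/suc n       ≈⟨ solve 4 (λ ε i K q → ε :* i :* K :* q := (q :* ε) :* (K :* i))
                                         refl ε (inv ε) K (1/suc n) ⟩
      (1/suc n * ε) * (K * inv ε)   <⟨ *-monoʳ-< (*-positive (1/suc-positive n) 0<ε)
                                         (<-≤-trans K/ε<N (×1-mono-≤ (ℕ.m≤n⇒m≤1+n N≤n))) ⟩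
      (1/suc n * ε) * (suc n ×ᴺ 1#) ≈⟨ solve 3 (λ q ε m → (q :* ε) :* m := m :* q :* ε)
                                         refl (1/suc n) ε (suc n ×ᴺ 1#) ⟩
      suc n ×ᴺ 1# * 1/suc n * ε     ≈⟨ trans (*-congʳ (1/suc-inverse n)) (*-identityˡ ε) ⟩
      ε                             ∎

-- Ring identities and the algebra of difference quotients

-- Identities between complex numbers are proved in an arbitrary commutative
-- ring, where the solver's terms do not unfold into real and imaginary parts.
module RingIdentities {c ℓ} (R : CommutativeRing c ℓ) where
  open CommutativeRing R
  open IntegerCoefficients R
  open Exp semiring using (_^_)
  open Mult semiring using () renaming (_×_ to _×ᴺ_)
  open SetoidReasoning setoid

  x+y-y≈x : ∀ x y → x + y - y ≈ x
  x+y-y≈x = solve 2 (λ x y → x :+ y :- y := x) refl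

  x+y+z≈x+z+y : ∀ x y z → x + y + z ≈ x + z + y
  x+y+z≈x+z+y = solve 3 (λ x y z → x :+ y :+ z := x :+ z :+ y) refl

  x-0≈x : ∀ x → x - 0# ≈ x
  x-0≈x = solve 1 (λ x → x :- con (+ 0) := x) refl

  x≈x-0 : ∀ x → x ≈ x - 0#
  x≈x-0 x = sym (x-0≈x x)

  0≈x-x : ∀ x → 0# ≈ x - x
  0≈x-x x = sym (-‿inverseʳ x)

  difference-of-sums : ∀ s t l m → (s - l) + (t - m) ≈ (s + t) - (l + m)
  difference-of-sums = solve 4 (λ s t l m → (s :- l) :+ (t :- m) := (s :+ t) :- (l :+ m)) refl

  difference-of-products : ∀ a s l → a * (s - l) ≈ a * s - a * l
  difference-of-products = solve 3 (λ a s l → a :* (s :- l) := a :* s :- a :* l) refl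

  -[s-l]+s≈l : ∀ s l → - (s - l) + s ≈ l
  -[s-l]+s≈l = solve 2 (λ s l → :- (s :- l) :+ s := l) refl

  difference-via : ∀ x y z → (x - z) - (y - z) ≈ x - y
  difference-via = solve 3 (λ x y z → (x :- z) :- (y :- z) := x :- y) refl

  x+x≈x⇒x≈0 : ∀ {x} → x + x ≈ x → x ≈ 0#
  x+x≈x⇒x≈0 {x} x+x≈x = begin
    x            ≈⟨ x+y-y≈x x x ⟨
    x + x - x    ≈⟨ +-congʳ x+x≈x ⟩
    x - x        ≈⟨ -‿inverseʳ x ⟩
    0#           ∎

  1+[x-1]≈x : ∀ x → 1# + (x - 1#) ≈ x
  1+[x-1]≈x = solve 1 (λ x → con (+ 1) :+ (x :- con (+ 1)) := x) refl

  x+[1+n]≈x+n+1 : ∀ x n → x + (1# + n) ≈ x + n + 1#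
  x+[1+n]≈x+n+1 = solve 2 (λ x n → x :+ (con (+ 1) :+ n) := x :+ n :+ con (+ 1)) refl

  0+n+1≈1+n : ∀ n → 0# + n + 1# ≈ 1# + n
  0+n+1≈1+n = solve 1 (λ n → con (+ 0) :+ n :+ con (+ 1) := con (+ 1) :+ n) refl

  -- Compares two decompositions of one total t; it is applied to Σ(f;1,x+n), cut at x and cut at n.
  split-sum : ∀ {s a b r t} → s + b ≈ t → a + r ≈ t → s - r ≈ a - b
  split-sum {s} {a} {b} {r} {t} s+b≈t a+r≈t = begin
    s - r              ≈⟨ solve 3 (λ s b r → s :- r := (s :+ b) :- r :- b) refl s b r ⟩
    (s + b) - r - b    ≈⟨ +-congʳ (+-congʳ (trans s+b≈t (sym a+r≈t))) ⟩
    (a + r) - r - b    ≈⟨ solve 3 (λ a b r → (a :+ r) :- r :- b := a :- b) refl a b r ⟩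
    a - b              ∎

  -x≈-1*x : ∀ x → - 1# * x ≈ - x
  -x≈-1*x = solve 1 (λ x → con -[1+ 0 ] :* x := :- x) refl

  *-distribˡ-sum : ∀ k x y → k * x + k * y ≈ k * (x + y)
  *-distribˡ-sum = solve 3 (λ k x y → k :* x :+ k :* y := k :* (x :+ y)) refl

  slope-sum-step : ∀ s t d x y z k →
    ((s - t) * k - d) + ((x - y) * k - z) ≈ ((s + x) - (t + y)) * k - (d + z)
  slope-sum-step = solve 7 (λ s t d x y z k →
    ((s :- t) :* k :- d) :+ ((x :- y) :* k :- z) := ((s :+ x) :- (t :+ y)) :* k :- (d :+ z)) refl

  slope-sum-zero : ∀ k → 0# ≈ (0# - 0#) * k - 0#
  slope-sum-zero = solve 1 (λ k → con (+ 0) := (con (+ 0) :- con (+ 0)) :* k :- con (+ 0)) refl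

  slope-of-differences : ∀ s t u k d →
    (t - u) * k - d ≈ ((s - u) - (s - t)) * k - d
  slope-of-differences = solve 5 (λ s t u k d →
    (t :- u) :* k :- d := ((s :- u) :- (s :- t)) :* k :- d) refl

  slope-at-zero : ∀ {y} x k → y ≈ 0# → (x - y) * k ≈ 1# * k * x
  slope-at-zero {y} x k y≈0 = trans (*-congʳ (+-congˡ (-‿cong y≈0)))
    (solve 2 (λ x k → (x :- con (+ 0)) :* k := con (+ 1) :* k :* x) refl x k)

  x-[x-y]≈y : ∀ x y → x + (- 1# * x - - 1# * y) ≈ y
  x-[x-y]≈y = solve 2 (λ x y → x :+ (con -[1+ 0 ] :* x :- con -[1+ 0 ] :* y) := y) refl

  *-inverse-unique : ∀ {x y z} → x * y ≈ 1# → x * z ≈ 1# → y ≈ z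
  *-inverse-unique {x} {y} {z} xy≈1 xz≈1 = begin
    y            ≈⟨ *-identityʳ y ⟨
    y * 1#       ≈⟨ *-congˡ xz≈1 ⟨
    y * (x * z)  ≈⟨ solve 3 (λ x y z → y :* (x :* z) := (x :* y) :* z) refl x y z ⟩
    (x * y) * z  ≈⟨ *-congʳ xy≈1 ⟩
    1# * z       ≈⟨ *-identityˡ z ⟩
    z            ∎

  ^-inverse : ∀ {x y} n → x * y ≈ 1# → x ^ n * y ^ n ≈ 1#
  ^-inverse zero            xy≈1 = *-identityˡ 1#
  ^-inverse {x} {y} (suc n) xy≈1 = begin
    (x * x ^ n) * (y * y ^ n)
      ≈⟨ solve 4 (λ x y u v → (x :* u) :* (y :* v) := (x :* y) :* (u :* v)) refl x y (x ^ n) (y ^ n) ⟩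
    (x * y) * (x ^ n * y ^ n)  ≈⟨ *-cong xy≈1 (^-inverse n xy≈1) ⟩
    1# * 1#                    ≈⟨ *-identityˡ 1# ⟩
    1#                         ∎

  -- If i = 1/u and j = 1/(u + h), then quotient a is (iᵃ - jᵃ)/h, and
  -- quotient₂ a is the next one: (quotient a - a iᵃ⁺¹)/h.
  module DifferenceQuotients (i j : Carrier) where
    quotient : ℕ → Carrier
    quotient zero    = 0#
    quotient (suc a) = i * quotient a + i * (j * j ^ a)

    quotient₂ : ℕ → Carrier
    quotient₂ zero    = 0#
    quotient₂ (suc a) = i * quotient₂ a - i * quotient (suc a)

    module _ {h} (i-j≈hij : i - j ≈ h * (i * j)) where
      -- From i·iᵃ - j·jᵃ = i(iᵃ - jᵃ) + (i - j)jᵃ: the first part is divisible by h by induction,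
      -- the second because i - j = hij. The recursion for `quotient` collects the two cofactors, so
      -- no division by h occurs.
      quotient-spec : ∀ a → i ^ a - j ^ a ≈ h * quotient a
      quotient-spec zero    = solve 1 (λ h → con (+ 1) :- con (+ 1) := h :* con (+ 0)) refl h
      quotient-spec (suc a) = begin
        i * i ^ a - j * j ^ a
          ≈⟨ solve 4 (λ i j u v → i :* u :- j :* v := i :* (u :- v) :+ (i :- j) :* v)
               refl i j (i ^ a) (j ^ a) ⟩
        i * (i ^ a - j ^ a) + (i - j) * j ^ a
          ≈⟨ +-cong (*-congˡ (quotient-spec a)) (*-congʳ i-j≈hij) ⟩
        i * (h * quotient a) + (h * (i * j)) * j ^ a
          ≈⟨ solve 5 (λ i j v h q → i :* (h :* q) :+ (h :* (i :* j)) :* v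
                       := h :* (i :* q :+ i :* (j :* v)))
               refl i j (j ^ a) h (quotient a) ⟩
        h * (i * quotient a + i * (j * j ^ a)) ∎

      -- Raising a by one leaves i times the previous error minus i(iᵃ⁺¹ - jᵃ⁺¹), and
      -- `quotient-spec` extracts the factor h from the latter.
      quotient₂-spec : ∀ a → quotient a - (a ×ᴺ 1#) * i ^ suc a ≈ h * quotient₂ a
      quotient₂-spec zero    = solve 2 (λ h u → con (+ 0) :- con (+ 0) :* u := h :* con (+ 0))
        refl h (i ^ 1)
      quotient₂-spec (suc a) = begin
        (i * q + i * (j * j ^ a)) - (1# + n) * (i * i ^ suc a)
          ≈⟨ solve 6 (λ i u q n v w →
               (i :* q :+ i :* v) :- (con (+ 1) :+ n) :* (i :* u)
                 := i :* (q :- n :* u) :- i :* (u :- v))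
               refl i (i ^ suc a) q n (j ^ suc a) h ⟩
        i * (q - n * i ^ suc a) - i * (i ^ suc a - j ^ suc a)
          ≈⟨ +-cong (*-congˡ (quotient₂-spec a)) (-‿cong (*-congˡ (quotient-spec (suc a)))) ⟩
        i * (h * quotient₂ a) - i * (h * quotient (suc a))
          ≈⟨ solve 4 (λ i h p q → i :* (h :* p) :- i :* (h :* q) := h :* (i :* p :- i :* q))
               refl i h (quotient₂ a) (quotient (suc a)) ⟩
        h * (i * quotient₂ a - i * quotient (suc a)) ∎
        where
        q = quotient a
        n = a ×ᴺ 1#

      slope-error : ∀ {k} a → h * k ≈ 1# →
        (i ^ a - j ^ a) * k - (a ×ᴺ 1#) * i ^ suc a ≈ h * quotient₂ a
      slope-error {k} a hk≈1 = begin
        (i ^ a - j ^ a) * k - e           ≈⟨ +-congʳ (*-congʳ (quotient-spec a)) ⟩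
        (h * quotient a) * k - e          ≈⟨ solve 4 (λ h q k e → (h :* q) :* k :- e
                                               := (h :* k) :* q :- e) refl h (quotient a) k e ⟩
        (h * k) * quotient a - e          ≈⟨ +-congʳ (trans (*-congʳ hk≈1) (*-identityˡ _)) ⟩
        quotient a - e                    ≈⟨ quotient₂-spec a ⟩
        h * quotient₂ a                   ∎
        where e = (a ×ᴺ 1#) * i ^ suc a

  reciprocal-difference : ∀ {u v h i j} → v ≈ u + h → u * i ≈ 1# → v * j ≈ 1# →
    i - j ≈ h * (i * j)
  reciprocal-difference {u} {v} {h} {i} {j} v≈u+h ui≈1 vj≈1 = begin
    i - j                          ≈⟨ +-cong (*-identityʳ i) (-‿cong (*-identityˡ j)) ⟨
    i * 1# - 1# * j                ≈⟨ +-cong (*-congˡ vj≈1) (-‿cong (*-congʳ ui≈1)) ⟨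
    i * (v * j) - (u * i) * j      ≈⟨ +-congʳ (*-congˡ (*-congʳ v≈u+h)) ⟩
    i * ((u + h) * j) - (u * i) * j
      ≈⟨ solve 4 (λ i u h j → i :* ((u :+ h) :* j) :- (u :* i) :* j := h :* (i :* j)) refl i u h j ⟩
    h * (i * j)                    ∎

-- Bounds on the modulus and on reciprocals of complex numbers

module ComplexBounds {c ℓ} (ℝ : CompleteOrderedField c ℓ) where
  open ComplexNumbers ℝ
  open RingIdentities ℂ-commutativeRing
  module ℝ = OrderedField ℝ
  open StrictReasoning ℝ.strictPartialOrder
  open Exp ℝ.semiring renaming (_^_ to _^ᴿ_) using ()

  ∣∣²-cong : ∀ {z w} → z ≈ w → ∣ z ∣² ℝ.≈ ∣ w ∣²
  ∣∣²-cong (p , q) = ℝ.+-cong (ℝ.*-cong p p) (ℝ.*-cong q q)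

  ∣∣²-* : ∀ z w → ∣ z * w ∣² ℝ.≈ ∣ z ∣² ℝ.* ∣ w ∣²
  ∣∣²-* (a , b) (c , d) = ℝ.solve 4
    (λ a b c d → (a ℝ.:* c ℝ.:- b ℝ.:* d) ℝ.:* (a ℝ.:* c ℝ.:- b ℝ.:* d)
                   ℝ.:+ (a ℝ.:* d ℝ.:+ b ℝ.:* c) ℝ.:* (a ℝ.:* d ℝ.:+ b ℝ.:* c)
                 ℝ.:= (a ℝ.:* a ℝ.:+ b ℝ.:* b) ℝ.:* (c ℝ.:* c ℝ.:+ d ℝ.:* d))
    ℝ.refl a b c d

  ∣∣²-neg : ∀ z → ∣ - z ∣² ℝ.≈ ∣ z ∣²
  ∣∣²-neg (a , b) = ℝ.solve 2
    (λ a b → ℝ.:- a ℝ.:* ℝ.:- a ℝ.:+ ℝ.:- b ℝ.:* ℝ.:- b ℝ.:= a ℝ.:* a ℝ.:+ b ℝ.:* b)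
    ℝ.refl a b

  ∣∣²-nonneg : ∀ z → ℝ.0# ℝ.≤ ∣ z ∣²
  ∣∣²-nonneg (a , b) = ℝ.+-nonneg (ℝ.square-nonneg a) (ℝ.square-nonneg b)

  ∣1∣² : ∣ 1# ∣² ℝ.≈ ℝ.1#
  ∣1∣² = ℝ.solve 0
    (ℝ.con (+ 1) ℝ.:* ℝ.con (+ 1) ℝ.:+ ℝ.con (+ 0) ℝ.:* ℝ.con (+ 0) ℝ.:= ℝ.con (+ 1)) ℝ.refl

  ∣0∣² : ∣ 0# ∣² ℝ.≈ ℝ.0#
  ∣0∣² = ℝ.solve 0
    (ℝ.con (+ 0) ℝ.:* ℝ.con (+ 0) ℝ.:+ ℝ.con (+ 0) ℝ.:* ℝ.con (+ 0) ℝ.:= ℝ.con (+ 0)) ℝ.refl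

  dot : ℂ → ℂ → ℝ.Carrier
  dot (a , b) (c , d) = a ℝ.* c ℝ.+ b ℝ.* d

  ∣∣²-+ : ∀ z w → ∣ z + w ∣² ℝ.≈ ∣ z ∣² ℝ.+ ∣ w ∣² ℝ.+ (dot z w ℝ.+ dot z w)
  ∣∣²-+ (a , b) (c , d) = ℝ.solve 4
    (λ a b c d → (a ℝ.:+ c) ℝ.:* (a ℝ.:+ c) ℝ.:+ (b ℝ.:+ d) ℝ.:* (b ℝ.:+ d)
       ℝ.:= (a ℝ.:* a ℝ.:+ b ℝ.:* b) ℝ.:+ (c ℝ.:* c ℝ.:+ d ℝ.:* d)
              ℝ.:+ ((a ℝ.:* c ℝ.:+ b ℝ.:* d) ℝ.:+ (a ℝ.:* c ℝ.:+ b ℝ.:* d)))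
    ℝ.refl a b c d

  -- Lagrange's identity: |z|²|w|² exceeds the square of `dot z w` by (ad - bc)².
  cauchy-schwarz : ∀ z w {r s} → ℝ.0# ℝ.≤ r → ℝ.0# ℝ.≤ s →
    ∣ z ∣² ℝ.≤ r ℝ.* r → ∣ w ∣² ℝ.≤ s ℝ.* s → dot z w ℝ.≤ r ℝ.* s
  cauchy-schwarz z@(a , b) w@(c , d) {r} {s} 0≤r 0≤s z≤r w≤s =
    ℝ.square-cancel-≤ (ℝ.*-nonneg 0≤r 0≤s) (begin
      dot z w ℝ.* dot z w
        ≤⟨ ℝ.x+nonneg (ℝ.square-nonneg (a ℝ.* d ℝ.- b ℝ.* c)) (ℝ.solve 4
             (λ a b c d → (a ℝ.:* a ℝ.:+ b ℝ.:* b) ℝ.:* (c ℝ.:* c ℝ.:+ d ℝ.:* d)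
                ℝ.:= (a ℝ.:* c ℝ.:+ b ℝ.:* d) ℝ.:* (a ℝ.:* c ℝ.:+ b ℝ.:* d)
                       ℝ.:+ (a ℝ.:* d ℝ.:- b ℝ.:* c) ℝ.:* (a ℝ.:* d ℝ.:- b ℝ.:* c))
             ℝ.refl a b c d) ⟩
      ∣ z ∣² ℝ.* ∣ w ∣²
        ≤⟨ ℝ.*-mono-≤ (∣∣²-nonneg z) (ℝ.square-nonneg s) z≤r w≤s ⟩
      (r ℝ.* r) ℝ.* (s ℝ.* s)
        ≈⟨ ℝ.solve 2 (λ r s → (r ℝ.:* r) ℝ.:* (s ℝ.:* s) ℝ.:= (r ℝ.:* s) ℝ.:* (r ℝ.:* s))
             ℝ.refl r s ⟩
      (r ℝ.* s) ℝ.* (r ℝ.* s) ∎)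

  square-of-sum : ∀ r s →
    (r ℝ.+ s) ℝ.* (r ℝ.+ s) ℝ.≈ r ℝ.* r ℝ.+ s ℝ.* s ℝ.+ (r ℝ.* s ℝ.+ r ℝ.* s)
  square-of-sum = ℝ.solve 2
    (λ r s → (r ℝ.:+ s) ℝ.:* (r ℝ.:+ s)
       ℝ.:= r ℝ.:* r ℝ.:+ s ℝ.:* s ℝ.:+ (r ℝ.:* s ℝ.:+ r ℝ.:* s)) ℝ.refl

  -- A bound on the modulus, stated without the square root.
  infix 4 ∣_∣≤_
  record ∣_∣≤_ (z : ℂ) (r : ℝ.Carrier) : Set (c ⊔ ℓ) where
    constructor bound
    field
      nonneg : ℝ.0# ℝ.≤ r
      square : ∣ z ∣² ℝ.≤ r ℝ.* r
  open ∣_∣≤_ public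

  ∣∣≤-cong : ∀ {z w r} → z ≈ w → ∣ z ∣≤ r → ∣ w ∣≤ r
  ∣∣≤-cong z≈w (bound 0≤r z≤r) = bound 0≤r (ℝ.≤-trans (ℝ.≤-reflexive (ℝ.sym (∣∣²-cong z≈w))) z≤r)

  ∣∣≤-mono : ∀ {z r s} → r ℝ.≤ s → ∣ z ∣≤ r → ∣ z ∣≤ s
  ∣∣≤-mono r≤s (bound 0≤r z≤r) =
    bound (ℝ.≤-trans 0≤r r≤s) (ℝ.≤-trans z≤r (ℝ.square-mono-≤ 0≤r r≤s))

  ∣∣≤-neg : ∀ {z r} → ∣ z ∣≤ r → ∣ - z ∣≤ r
  ∣∣≤-neg {z} (bound 0≤r z≤r) = bound 0≤r (ℝ.≤-trans (ℝ.≤-reflexive (∣∣²-neg z)) z≤r)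

  ∣∣≤-+ : ∀ {z w r s} → ∣ z ∣≤ r → ∣ w ∣≤ s → ∣ z + w ∣≤ r ℝ.+ s
  ∣∣≤-+ {z} {w} {r} {s} (bound 0≤r z≤r) (bound 0≤s w≤s) = bound (ℝ.+-nonneg 0≤r 0≤s) (begin
    ∣ z + w ∣²                                            ≈⟨ ∣∣²-+ z w ⟩
    ∣ z ∣² ℝ.+ ∣ w ∣² ℝ.+ (dot z w ℝ.+ dot z w)
      ≤⟨ ℝ.+-mono-≤ (ℝ.+-mono-≤ z≤r w≤s) (ℝ.+-mono-≤ cs cs) ⟩
    r ℝ.* r ℝ.+ s ℝ.* s ℝ.+ (r ℝ.* s ℝ.+ r ℝ.* s)         ≈⟨ square-of-sum r s ⟨
    (r ℝ.+ s) ℝ.* (r ℝ.+ s)                               ∎)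
    where cs = cauchy-schwarz z w 0≤r 0≤s z≤r w≤s

  ∣∣<-+-∣∣≤ : ∀ {z w r s} → ℝ.0# ℝ.< r → ∣ z ∣< r → ∣ w ∣≤ s → ∣ z + w ∣< (r ℝ.+ s)
  ∣∣<-+-∣∣≤ {z} {w} {r} {s} 0<r z<r (bound 0≤s w≤s) = begin-strict
    ∣ z + w ∣²                                            ≈⟨ ∣∣²-+ z w ⟩
    ∣ z ∣² ℝ.+ ∣ w ∣² ℝ.+ (dot z w ℝ.+ dot z w)
      <⟨ ℝ.+-mono-<-≤ (ℝ.+-mono-<-≤ z<r w≤s) (ℝ.+-mono-≤ cs cs) ⟩
    r ℝ.* r ℝ.+ s ℝ.* s ℝ.+ (r ℝ.* s ℝ.+ r ℝ.* s)         ≈⟨ square-of-sum r s ⟨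
    (r ℝ.+ s) ℝ.* (r ℝ.+ s)                               ∎
    where cs = cauchy-schwarz z w (ℝ.<⇒≤ 0<r) 0≤s (ℝ.<⇒≤ z<r) w≤s

  ∣∣≤-* : ∀ {z w r s} → ∣ z ∣≤ r → ∣ w ∣≤ s → ∣ z * w ∣≤ r ℝ.* s
  ∣∣≤-* {z} {w} {r} {s} (bound 0≤r z≤r) (bound 0≤s w≤s) = bound (ℝ.*-nonneg 0≤r 0≤s) (begin
    ∣ z * w ∣²               ≈⟨ ∣∣²-* z w ⟩
    ∣ z ∣² ℝ.* ∣ w ∣²        ≤⟨ ℝ.*-mono-≤ (∣∣²-nonneg z) (ℝ.square-nonneg s) z≤r w≤s ⟩
    (r ℝ.* r) ℝ.* (s ℝ.* s)  ≈⟨ ℝ.solve 2 (λ r s → (r ℝ.:* r) ℝ.:* (s ℝ.:* s)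
                                   ℝ.:= (r ℝ.:* s) ℝ.:* (r ℝ.:* s)) ℝ.refl r s ⟩
    (r ℝ.* s) ℝ.* (r ℝ.* s)  ∎)

  ∣0∣≤0 : ∣ 0# ∣≤ ℝ.0#
  ∣0∣≤0 = bound ℝ.≤-refl (ℝ.≤-reflexive (ℝ.trans ∣0∣² (ℝ.sym (ℝ.zeroˡ _))))

  ∣1∣≤1 : ∣ 1# ∣≤ ℝ.1#
  ∣1∣≤1 = bound (ℝ.<⇒≤ ℝ.0<1) (ℝ.≤-reflexive (ℝ.trans ∣1∣² (ℝ.sym (ℝ.*-identityˡ _))))

  ∣fromℕ∣≤ : ∀ n → ∣ fromℕ n ∣≤ n ℝ.×ᴺ ℝ.1#
  ∣fromℕ∣≤ zero    = ∣0∣≤0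
  ∣fromℕ∣≤ (suc n) = ∣∣≤-+ ∣1∣≤1 (∣fromℕ∣≤ n)

  ∣^∣≤ : ∀ {z r} n → ∣ z ∣≤ r → ∣ z ^ n ∣≤ r ^ᴿ n
  ∣^∣≤ zero    z≤r = ∣1∣≤1
  ∣^∣≤ (suc n) z≤r = ∣∣≤-* z≤r (∣^∣≤ n z≤r)

  ∣∣≤⇒∣∣< : ∀ {z r ε} → ∣ z ∣≤ r → r ℝ.< ε → ∣ z ∣< ε
  ∣∣≤⇒∣∣< (bound 0≤r z≤r) r<ε = ℝ.≤-<-trans z≤r (ℝ.square-mono-< 0≤r r<ε)

  ∣∣<⇒∣∣≤ : ∀ {z ε} → ℝ.0# ℝ.< ε → ∣ z ∣< ε → ∣ z ∣≤ ε
  ∣∣<⇒∣∣≤ 0<ε z<ε = bound (ℝ.<⇒≤ 0<ε) (ℝ.<⇒≤ z<ε)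

  ∣∣<-mono : ∀ {z ε δ} → ℝ.0# ℝ.< δ → δ ℝ.≤ ε → ∣ z ∣< δ → ∣ z ∣< ε
  ∣∣<-mono 0<δ δ≤ε z<δ = ℝ.<-≤-trans z<δ (ℝ.square-mono-≤ (ℝ.<⇒≤ 0<δ) δ≤ε)

  ∣∣<-cong : ∀ {z w ε} → z ≈ w → ∣ z ∣< ε → ∣ w ∣< ε
  ∣∣<-cong z≈w = ℝ.<-respˡ-≈ (∣∣²-cong z≈w)

  -- A bound for |z| that avoids the square root: q ≤ (1 + q)² for q = |z|² ≥ 0. It is also
  -- positive, so it can be inverted.
  ∣∣≤-1+square : ∀ z → ∣ z ∣≤ ℝ.1# ℝ.+ ∣ z ∣²
  ∣∣≤-1+square z = bound (ℝ.+-nonneg 0≤1 0≤q)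
    (ℝ.x+nonneg (ℝ.+-nonneg (ℝ.+-nonneg 0≤1 0≤q) (ℝ.square-nonneg q))
      (ℝ.solve 1 (λ q → (ℝ.con (+ 1) ℝ.:+ q) ℝ.:* (ℝ.con (+ 1) ℝ.:+ q)
                    ℝ.:= q ℝ.:+ ((ℝ.con (+ 1) ℝ.:+ q) ℝ.:+ q ℝ.:* q)) ℝ.refl q))
    where
    q   = ∣ z ∣²
    0≤q = ∣∣²-nonneg z
    0≤1 = ℝ.<⇒≤ ℝ.0<1

  bounded : ∀ z → ∃ λ N → ∣ z ∣≤ N ℝ.×ᴺ ℝ.1#
  bounded z with ℝ.archimedean (ℝ.1# ℝ.+ ∣ z ∣²)
  ... | N , q<N = N , ∣∣≤-mono (ℝ.<⇒≤ q<N) (∣∣≤-1+square z)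

  re≤ : ∀ {z r} → ∣ z ∣≤ r → proj₁ z ℝ.≤ r
  re≤ {a , b} (bound 0≤r z≤r) =
    ℝ.square-cancel-≤ 0≤r (ℝ.≤-trans (ℝ.x+nonneg (ℝ.square-nonneg b) ℝ.refl) z≤r)

  im≤ : ∀ {z r} → ∣ z ∣≤ r → proj₂ z ℝ.≤ r
  im≤ {a , b} (bound 0≤r z≤r) =
    ℝ.square-cancel-≤ 0≤r (ℝ.≤-trans (ℝ.x+nonneg (ℝ.square-nonneg a) (ℝ.+-comm _ _)) z≤r)

  -- Here m is a lower bound for |z| and r its reciprocal. Then m²|z⁻¹|² ≤ |z z⁻¹|² = 1 = m²r², and
  -- m² cancels; m r = 1 excludes m = 0 and so also z = 0.
  ∣⁻¹∣≤ : ∀ {z m r} → ℝ.0# ℝ.≤ m → ℝ.0# ℝ.≤ r → m ℝ.* r ℝ.≈ ℝ.1# → m ℝ.* m ℝ.≤ ∣ z ∣² →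
    z ≉0 × ∣ z ⁻¹ ∣≤ r
  ∣⁻¹∣≤ {z} {m} {r} 0≤m 0≤r mr≈1 mm≤z = z≉0 , bound 0≤r (ℝ.*-cancelˡ-≤ 0<mm (begin
    (m ℝ.* m) ℝ.* ∣ z ⁻¹ ∣²    ≤⟨ ℝ.*-mono-≤ (ℝ.square-nonneg m) (∣∣²-nonneg (z ⁻¹)) mm≤z ℝ.≤-refl ⟩
    ∣ z ∣² ℝ.* ∣ z ⁻¹ ∣²       ≈⟨ ∣∣²-* z (z ⁻¹) ⟨
    ∣ z * z ⁻¹ ∣²              ≈⟨ ∣∣²-cong (⁻¹-inverse z z≉0) ⟩
    ∣ 1# ∣²                    ≈⟨ ∣1∣² ⟩
    ℝ.1#                       ≈⟨ mmrr≈1 ⟨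
    (m ℝ.* m) ℝ.* (r ℝ.* r)    ∎))
    where
    mmrr≈1 : (m ℝ.* m) ℝ.* (r ℝ.* r) ℝ.≈ ℝ.1#
    mmrr≈1 = ℝ.trans
      (ℝ.solve 2 (λ m r → (m ℝ.:* m) ℝ.:* (r ℝ.:* r) ℝ.:= (m ℝ.:* r) ℝ.:* (m ℝ.:* r)) ℝ.refl m r)
      (ℝ.trans (ℝ.*-cong mr≈1 mr≈1) (ℝ.*-identityˡ _))
    0<mm : ℝ.0# ℝ.< m ℝ.* m
    0<mm with ℝ.square-nonneg m
    ... | inj₁ 0<mm = 0<mm
    ... | inj₂ 0≈mm = contradiction
      (ℝ.trans (ℝ.sym mmrr≈1) (ℝ.trans (ℝ.*-congʳ (ℝ.sym 0≈mm)) (ℝ.zeroˡ _))) ℝ.1≉0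
    z≉0 : z ≉0
    z≉0 z≈0 = ℝ.≤⇒≯ mm≤z (ℝ.<-respˡ-≈ (ℝ.sym (ℝ.trans (∣∣²-cong z≈0) ∣0∣²)) 0<mm)

  ∣fromℕ∣² : ∀ n → ∣ fromℕ n ∣² ℝ.≈ n ℝ.×ᴺ ℝ.1# ℝ.* n ℝ.×ᴺ ℝ.1#
  ∣fromℕ∣² n = ℝ.trans (ℝ.+-cong (ℝ.*-cong (re n) (re n)) (ℝ.trans (ℝ.*-congʳ (im n)) (ℝ.zeroˡ _)))
                       (ℝ.+-identityʳ _)
    where
    re : ∀ n → proj₁ (fromℕ n) ℝ.≈ n ℝ.×ᴺ ℝ.1#
    re zero    = ℝ.refl
    re (suc n) = ℝ.+-congˡ (re n)
    im : ∀ n → proj₂ (fromℕ n) ℝ.≈ ℝ.0#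
    im zero    = ℝ.refl
    im (suc n) = ℝ.trans (ℝ.+-identityˡ _) (im n)

  half-inverse : ∀ {x y} → x ℝ.* y ℝ.≈ ℝ.1# → ℝ.half x ℝ.* (y ℝ.+ y) ℝ.≈ ℝ.1#
  half-inverse {x} {y} xy≈1 = begin-equality
    ℝ.half x ℝ.* (y ℝ.+ y)             ≈⟨ ℝ.solve 2 (λ h y → h ℝ.:* (y ℝ.:+ y) ℝ.:= (h ℝ.:+ h) ℝ.:* y)
                                            ℝ.refl (ℝ.half x) y ⟩
    (ℝ.half x ℝ.+ ℝ.half x) ℝ.* y      ≈⟨ ℝ.*-congʳ (ℝ.half+half x) ⟩
    x ℝ.* y                            ≈⟨ xy≈1 ⟩
    ℝ.1#                               ∎

  -- If |z + w| were below m/2, then z = (z + w) - w would have modulus below m. So |z + w| ≥ m/2,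
  -- and 2r is the reciprocal of m/2.
  perturbed-reciprocal : ∀ {z w m r} → ℝ.0# ℝ.< m → ℝ.0# ℝ.≤ r → m ℝ.* r ℝ.≈ ℝ.1# →
    m ℝ.* m ℝ.≤ ∣ z ∣² → ∣ w ∣≤ ℝ.half m → (z + w) ≉0 × ∣ (z + w) ⁻¹ ∣≤ r ℝ.+ r
  perturbed-reciprocal {z} {w} {m} {r} 0<m 0≤r mr≈1 m≤z w≤ =
    ∣⁻¹∣≤ (nonneg w≤) (ℝ.+-nonneg 0≤r 0≤r) (half-inverse mr≈1) (ℝ.≮⇒≥ λ z+w< →
      ℝ.≤⇒≯ m≤z (ℝ.<-respˡ-≈ (∣∣²-cong (x+y-y≈x z w))
        (ℝ.<-respʳ-≈ (ℝ.*-cong (ℝ.half+half m) (ℝ.half+half m))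
          (∣∣<-+-∣∣≤ {z + w} { - w} (ℝ.half-positive 0<m) z+w< (∣∣≤-neg w≤)))))

  -- The integer n + 1 is the main term and z the perturbation, which has size at most N ≤ (n+1)/2;
  -- this is the origin of the factor 2.
  far-reciprocal : ∀ {z N n} → ∣ z ∣≤ N ℝ.×ᴺ ℝ.1# → N ℕ.+ N ℕ.≤ suc n →
    (z + fromℕ (suc n)) ≉0 × ∣ (z + fromℕ (suc n)) ⁻¹ ∣≤ (ℝ.1# ℝ.+ ℝ.1#) ℝ.* ℝ.1/suc n
  far-reciprocal {z} {N} {n} z≤N 2N≤n =
    (λ z+n≈0 → proj₁ n+z (trans n+z≈z+n z+n≈0)) ,
    ∣∣≤-mono (ℝ.≤-reflexive (ℝ.sym (double (ℝ.1/suc n)))) (∣∣≤-cong (⁻¹-cong n+z≈z+n) (proj₂ n+z))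
    where
    open Mult ℝ.semiring using (×-homo-+)
    s = suc n ℝ.×ᴺ ℝ.1#
    double : ∀ x → (ℝ.1# ℝ.+ ℝ.1#) ℝ.* x ℝ.≈ x ℝ.+ x
    double = ℝ.solve 1 (λ x → (ℝ.con (+ 1) ℝ.:+ ℝ.con (+ 1)) ℝ.:* x ℝ.:= x ℝ.:+ x) ℝ.refl
    N≤ : N ℝ.×ᴺ ℝ.1# ℝ.≤ ℝ.half s
    N≤ = ℝ.*-cancelˡ-≤ (ℝ.+-positive ℝ.0<1 ℝ.0<1) (begin
      (ℝ.1# ℝ.+ ℝ.1#) ℝ.* N ℝ.×ᴺ ℝ.1#       ≈⟨ double _ ⟩
      N ℝ.×ᴺ ℝ.1# ℝ.+ N ℝ.×ᴺ ℝ.1#           ≈⟨ ×-homo-+ ℝ.1# N N ⟨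
      (N ℕ.+ N) ℝ.×ᴺ ℝ.1#                   ≤⟨ ℝ.×1-mono-≤ 2N≤n ⟩
      s                                     ≈⟨ ℝ.half+half s ⟨
      ℝ.half s ℝ.+ ℝ.half s                 ≈⟨ double _ ⟨
      (ℝ.1# ℝ.+ ℝ.1#) ℝ.* ℝ.half s          ∎)
    n+z≈z+n : fromℕ (suc n) + z ≈ z + fromℕ (suc n)
    n+z≈z+n = +-comm (fromℕ (suc n)) z
    n+z : (fromℕ (suc n) + z) ≉0 × ∣ (fromℕ (suc n) + z) ⁻¹ ∣≤ ℝ.1/suc n ℝ.+ ℝ.1/suc n
    n+z = perturbed-reciprocal {fromℕ (suc n)} {z} (ℝ.0<suc×1 n) (ℝ.<⇒≤ (ℝ.1/suc-positive n))
      (ℝ.1/suc-inverse n) (ℝ.≤-reflexive (ℝ.sym (∣fromℕ∣² (suc n)))) (∣∣≤-mono N≤ z≤N)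

-- Limits of complex sequences and convergence by comparison with ∑ 1/ν²

module ComplexLimits {c ℓ} (ℝ : CompleteOrderedField c ℓ) where
  open ComplexNumbers ℝ
  open ComplexBounds ℝ
  open RingIdentities ℂ-commutativeRing
  open StrictReasoning ℝ.strictPartialOrder

  ⟶-cong : ∀ {s t l m} → (∀ n → s n ≈ t n) → l ≈ m → s ⟶ l → t ⟶ m
  ⟶-cong {s} {t} {l} {m} s≈t l≈m s⟶l ε 0<ε with s⟶l ε 0<ε
  ... | N , close = N , λ n N≤n →
    ∣∣<-cong {s n - l} {t n - m} (+-cong (s≈t n) (-‿cong l≈m)) (close n N≤n)

  ⟶-+ : ∀ {s t l m} → s ⟶ l → t ⟶ m → (λ n → s n + t n) ⟶ (l + m)
  ⟶-+ {s} {t} {l} {m} s⟶l t⟶m ε 0<ε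
    with s⟶l (ℝ.half ε) (ℝ.half-positive 0<ε) | t⟶m (ℝ.half ε) (ℝ.half-positive 0<ε)
  ... | M , s-close | N , t-close = M ℕ.⊔ N , λ n M⊔N≤n →
    ℝ.<-respʳ-≈ (ℝ.*-cong (ℝ.half+half ε) (ℝ.half+half ε))
      (∣∣<-cong {(s n - l) + (t n - m)} {(s n + t n) - (l + m)} (difference-of-sums (s n) (t n) l m)
        (∣∣<-+-∣∣≤ {s n - l} {t n - m} 0<ε/2
          (s-close n (ℕ.m⊔n≤o⇒m≤o M N M⊔N≤n))
          (∣∣<⇒∣∣≤ 0<ε/2 (t-close n (ℕ.m⊔n≤o⇒n≤o M N M⊔N≤n)))))
    where 0<ε/2 = ℝ.half-positive 0<ε

  ⟶-* : ∀ a {s l} → s ⟶ l → (λ n → a * s n) ⟶ (a * l)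
  ⟶-* a {s} {l} s⟶l ε 0<ε = proj₁ (s⟶l δ 0<δ) , λ n N≤n →
    ∣∣<-cong {a * (s n - l)} {a * s n - a * l} (difference-of-products a (s n) l)
      (∣∣≤⇒∣∣<
        (∣∣≤-* (∣∣≤-1+square a) (∣∣<⇒∣∣≤ {s n - l} 0<δ (proj₂ (s⟶l δ 0<δ) n N≤n)))
        (ℝ.<-respˡ-≈ (ℝ.sym Mδ≈ε/2) (ℝ.half< 0<ε)))
    where
    M   = ℝ.1# ℝ.+ ∣ a ∣²
    0<M = ℝ.<-≤-trans ℝ.0<1 (ℝ.x+nonneg (∣∣²-nonneg a) ℝ.refl)
    -- Aiming at ε/2 turns the weak inequality from `∣∣≤-*` into the strict one that a limit
    -- requires.
    δ   = ℝ.half ε ℝ.* ℝ.inv M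
    0<δ = ℝ.*-positive (ℝ.half-positive 0<ε) (ℝ.inv-positive 0<M)
    Mδ≈ε/2 : M ℝ.* δ ℝ.≈ ℝ.half ε
    Mδ≈ε/2 = ℝ.trans
      (ℝ.solve 3 (λ M e i → M ℝ.:* (e ℝ.:* i) ℝ.:= M ℝ.:* i ℝ.:* e) ℝ.refl M (ℝ.half ε) (ℝ.inv M))
      (ℝ.x*invx*y≈y (ℝ.half ε) 0<M)

  ⟶-difference : ∀ {s t l m} → s ⟶ l → t ⟶ m → (λ n → s n - t n) ⟶ (l - m)
  ⟶-difference {s} {t} {l} {m} s⟶l t⟶m =
    ⟶-+ {s} {λ n → - t n} {l} { - m} s⟶l
      (⟶-cong {λ n → - 1# * t n} {λ n → - t n} { - 1# * m} { - m}
        (λ n → -x≈-1*x (t n)) (-x≈-1*x m) (⟶-* (- 1#) {t} {m} t⟶m))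

  ⟶-constant : ∀ l → (λ _ → l) ⟶ l
  ⟶-constant l ε 0<ε = 0 , λ _ _ →
    ∣∣≤⇒∣∣< (∣∣≤-cong {0#} {l - l} (0≈x-x l) ∣0∣≤0) 0<ε

  -- The limit is -(s N - l) + s N for an N at which the first term is below η. The slack η keeps
  -- the conclusion strict.
  ⟶-bound : ∀ {s l r η} → s ⟶ l → (∀ n → ∣ s n ∣≤ r) → ℝ.0# ℝ.< η → ∣ l ∣< (η ℝ.+ r)
  ⟶-bound {s} {l} {r} {η} s⟶l s≤r 0<η with s⟶l η 0<η
  ... | N , close =
    ∣∣<-cong { - (s N - l) + s N} {l} (-[s-l]+s≈l (s N) l)
      (∣∣<-+-∣∣≤ { - (s N - l)} {s N} 0<η
        (ℝ.<-respˡ-≈ (ℝ.sym (∣∣²-neg (s N - l))) (close N ℕ.≤-refl)) (s≤r N))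

  O[1/n]⟶0 : ∀ {s} K N → ℝ.0# ℝ.≤ K → (∀ n → N ℕ.≤ n → ∣ s (suc n) ∣≤ K ℝ.* ℝ.1/suc n) → s ⟶ 0#
  O[1/n]⟶0 {s} K N 0≤K s≤ ε 0<ε with ℝ.1/suc-small K ε 0≤K 0<ε
  ... | M , small = suc (N ℕ.⊔ M) , λ where
    (suc n) (ℕ.s≤s N⊔M≤n) → ∣∣<-cong {s (suc n)} {s (suc n) - 0#} (x≈x-0 (s (suc n)))
      (∣∣≤⇒∣∣< (s≤ n (ℕ.m⊔n≤o⇒m≤o N M N⊔M≤n)) (small n (ℕ.m⊔n≤o⇒n≤o N M N⊔M≤n)))

  -- An upper bound for ∑ 1/ν² over ν > n.
  tail : ℕ → ℝ.Carrier
  tail zero    = ℝ.1# ℝ.+ ℝ.1#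
  tail (suc n) = ℝ.1/suc n

  tail-nonneg : ∀ n → ℝ.0# ℝ.≤ tail n
  tail-nonneg zero    = ℝ.<⇒≤ (ℝ.+-positive ℝ.0<1 ℝ.0<1)
  tail-nonneg (suc n) = ℝ.<⇒≤ (ℝ.1/suc-positive n)

  -- For n ≥ 1 this is the comparison `square-1/suc`. For n = 0 the term 1/1² is counted separately,
  -- whence the value 2 of `tail zero`.
  tail-step : ∀ n → ℝ.1/suc n ℝ.* ℝ.1/suc n ℝ.+ tail (suc n) ℝ.≤ tail n
  tail-step zero    = ℝ.+-mono-≤
    (ℝ.≤-trans (ℝ.square-mono-≤ (ℝ.<⇒≤ (ℝ.1/suc-positive 0)) (ℝ.1/suc≤1 0))
               (ℝ.≤-reflexive (ℝ.*-identityˡ _)))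
    (ℝ.1/suc≤1 0)
  tail-step (suc n) = ℝ.square-1/suc n

  ∑-tail-bound : ∀ {F} K → ℝ.0# ℝ.≤ K →
    (∀ n → ∣ F (suc n) ∣≤ K ℝ.* (ℝ.1/suc n ℝ.* ℝ.1/suc n)) →
    ∀ n k → ∣ ∑[1… k ℕ.+ n ] F - ∑[1… n ] F ∣≤ K ℝ.* tail n
  ∑-tail-bound {F} K 0≤K F≤ n k = ∣∣≤-mono (ℝ.*-monoʳ-≤ 0≤K
      (ℝ.x+nonneg (tail-nonneg (k ℕ.+ n))
        (ℝ.solve 2 (λ x y → x ℝ.:= (x ℝ.:- y) ℝ.:+ y) ℝ.refl (tail n) (tail (k ℕ.+ n)))))
    (telescoped k)
    where
    S = ∑[1… n ] F
    -- The induction needs the sharper bound with `tail (k + n)` subtracted: each further term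
    -- consumes one `tail-step`.
    telescoped : ∀ k → ∣ ∑[1… k ℕ.+ n ] F - S ∣≤ K ℝ.* (tail n ℝ.- tail (k ℕ.+ n))
    telescoped zero    = ∣∣≤-mono
      (ℝ.≤-reflexive (ℝ.solve 2 (λ K b → ℝ.con (+ 0) ℝ.:= K ℝ.:* (b ℝ.:- b)) ℝ.refl K (tail n)))
      (∣∣≤-cong {0#} {S - S} (0≈x-x S) ∣0∣≤0)
    telescoped (suc k) = ∣∣≤-mono
      (begin
        K ℝ.* (b ℝ.- b′) ℝ.+ K ℝ.* (q ℝ.* q)
          ≤⟨ ℝ.x+nonneg (ℝ.*-nonneg 0≤K (ℝ.0≤y-x (tail-step (k ℕ.+ n))))
               (ℝ.solve 5 (λ K b b′ b″ q → K ℝ.:* (b ℝ.:- b″)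
                  ℝ.:= (K ℝ.:* (b ℝ.:- b′) ℝ.:+ K ℝ.:* (q ℝ.:* q))
                         ℝ.:+ K ℝ.:* (b′ ℝ.:- (q ℝ.:* q ℝ.:+ b″)))
                  -- The last two arguments coincide because `tail (suc m)` unfolds to `1/suc m`.
                  ℝ.refl K b b′ q q) ⟩
        K ℝ.* (b ℝ.- q) ∎)
      (∣∣≤-cong (x+y+z≈x+z+y (∑[1… k ℕ.+ n ] F) (- S) (F (suc (k ℕ.+ n))))
        (∣∣≤-+ {∑[1… k ℕ.+ n ] F - S} {F (suc (k ℕ.+ n))} (telescoped k) (F≤ (k ℕ.+ n))))
      where
      b  = tail n
      b′ = tail (k ℕ.+ n)
      q  = ℝ.1/suc (k ℕ.+ n)

  ∑-bound : ∀ {F} K → ℝ.0# ℝ.≤ K →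
    (∀ n → ∣ F (suc n) ∣≤ K ℝ.* (ℝ.1/suc n ℝ.* ℝ.1/suc n)) →
    ∀ n → ∣ ∑[1… n ] F ∣≤ K ℝ.* tail 0
  ∑-bound {F} K 0≤K F≤ n = ≡.subst (λ m → ∣ ∑[1… m ] F ∣≤ K ℝ.* tail 0) (ℕ.+-identityʳ n)
    (∣∣≤-cong (x-0≈x (∑[1… n ℕ.+ 0 ] F)) (∑-tail-bound K 0≤K F≤ 0 n))

  -- The difference e² - (x-y)² is the product of the two positive gaps e - (x-y) and e - (y-x).
  near-square : ∀ e x y → ℝ.Near e x y → (x ℝ.- y) ℝ.* (x ℝ.- y) ℝ.< e ℝ.* e
  near-square e x y (x-y<e , y-x<e) =
    ℝ.x+positive (ℝ.*-positive (ℝ.0<y-x x-y<e) (ℝ.0<y-x y-x<e))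
      (ℝ.solve 3 (λ e x y → e ℝ.:* e ℝ.:= (x ℝ.:- y) ℝ.:* (x ℝ.:- y)
                    ℝ.:+ (e ℝ.:- (x ℝ.:- y)) ℝ.:* (e ℝ.:- (y ℝ.:- x))) ℝ.refl e x y)

  componentwise-⟶ : ∀ {s : ℕ → ℂ} {a b} →
    (∀ ε → ℝ.0# ℝ.< ε → ∃ λ N → ∀ n → N ℕ.≤ n → ℝ.Near ε (proj₁ (s n)) a) →
    (∀ ε → ℝ.0# ℝ.< ε → ∃ λ N → ∀ n → N ℕ.≤ n → ℝ.Near ε (proj₂ (s n)) b) →
    s ⟶ (a , b)
  componentwise-⟶ {s} {a} {b} re⟶a im⟶b ε 0<ε
    with re⟶a (ℝ.half ε) (ℝ.half-positive 0<ε) | im⟶b (ℝ.half ε) (ℝ.half-positive 0<ε)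
  ... | M , re-near | N , im-near = M ℕ.⊔ N , λ n M⊔N≤n → begin-strict
    ∣ s n - (a , b) ∣²
      <⟨ ℝ.+-mono-<-≤ (near-square e (proj₁ (s n)) a (re-near n (ℕ.m⊔n≤o⇒m≤o M N M⊔N≤n)))
           (ℝ.<⇒≤ (near-square e (proj₂ (s n)) b (im-near n (ℕ.m⊔n≤o⇒n≤o M N M⊔N≤n)))) ⟩
    e ℝ.* e ℝ.+ e ℝ.* e
      ≤⟨ ℝ.x+nonneg (ℝ.+-nonneg 0≤ee 0≤ee) (square-of-sum e e) ⟩
    (e ℝ.+ e) ℝ.* (e ℝ.+ e)
      ≈⟨ ℝ.*-cong (ℝ.half+half ε) (ℝ.half+half ε) ⟩
    ε ℝ.* ε ∎
    where
    e    = ℝ.half ε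
    0≤ee = ℝ.square-nonneg e

  cauchy⇒converges : ∀ {s} K → ℝ.0# ℝ.≤ K →
    (∀ n k → ∣ s (k ℕ.+ n) - s n ∣≤ K ℝ.* tail n) → Converges s
  cauchy⇒converges {s} K 0≤K s-tail =
    (proj₁ re-limit , proj₁ im-limit) , componentwise-⟶ (proj₂ re-limit) (proj₂ im-limit)
    where
    -- Both indices are compared with the base `suc N`, where the tail is 1/(N+1). One modulus bound
    -- r then serves the real and the imaginary parts.
    close : ∀ ε → ℝ.0# ℝ.< ε → ∃ λ N → ∀ m n → N ℕ.≤ m → N ℕ.≤ n →
      ∃ λ r → r ℝ.< ε × ∣ s m - s n ∣≤ r
    close ε 0<ε with ℝ.1/suc-small K (ℝ.half ε) 0≤K (ℝ.half-positive 0<ε)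
    ... | N , small = suc N , λ m n N<m N<n →
      r ℝ.+ r ,
      ℝ.<-respʳ-≈ (ℝ.half+half ε) (ℝ.+-mono-<-≤ (small N ℕ.≤-refl) (ℝ.<⇒≤ (small N ℕ.≤-refl))) ,
      ∣∣≤-cong (difference-via (s m) (s n) (s (suc N)))
        (∣∣≤-+ {s m - s (suc N)} { - (s n - s (suc N))}
          (from-suc-N m N<m) (∣∣≤-neg {s n - s (suc N)} (from-suc-N n N<n)))
      where
      r = K ℝ.* ℝ.1/suc N
      from-suc-N : ∀ m → suc N ℕ.≤ m → ∣ s m - s (suc N) ∣≤ r
      from-suc-N m N<m = ≡.subst (λ k → ∣ s k - s (suc N) ∣≤ r) (ℕ.m∸n+n≡m N<m)
        (s-tail (suc N) (m ℕ.∸ suc N))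

    re-limit : ∃ λ a → ∀ ε → ℝ.0# ℝ.< ε → ∃ λ N → ∀ n → N ℕ.≤ n → ℝ.Near ε (proj₁ (s n)) a
    re-limit = ℝ.complete (λ n → proj₁ (s n)) λ ε 0<ε → proj₁ (close ε 0<ε) , λ m n N≤m N≤n →
      let (_ , r<ε , mn) = proj₂ (close ε 0<ε) m n N≤m N≤n
          (_ , r′<ε , nm) = proj₂ (close ε 0<ε) n m N≤n N≤m
      in ℝ.≤-<-trans (re≤ mn) r<ε , ℝ.≤-<-trans (re≤ nm) r′<ε

    im-limit : ∃ λ b → ∀ ε → ℝ.0# ℝ.< ε → ∃ λ N → ∀ n → N ℕ.≤ n → ℝ.Near ε (proj₂ (s n)) b
    im-limit = ℝ.complete (λ n → proj₂ (s n)) λ ε 0<ε → proj₁ (close ε 0<ε) , λ m n N≤m N≤n →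
      let (_ , r<ε , mn) = proj₂ (close ε 0<ε) m n N≤m N≤n
          (_ , r′<ε , nm) = proj₂ (close ε 0<ε) n m N≤n N≤m
      in ℝ.≤-<-trans (im≤ mn) r<ε , ℝ.≤-<-trans (im≤ nm) r′<ε

-- Uniform bounds for 1/(x+h+ν) and for the difference quotients

module Reciprocals {c ℓ} (ℝ : CompleteOrderedField c ℓ) where
  open ComplexNumbers ℝ
  open ComplexBounds ℝ
  open RingIdentities ℂ-commutativeRing
  open Exp ℝ.semiring renaming (_^_ to _^ᴿ_) using ()
  open StrictReasoning ℝ.strictPartialOrder

  -- The uniform form of 1/(x+h+ν) = O(1/ν), with ν = n + 1 and one radius and constant for all n in
  -- P. Restricting n to P allows bounds for different ranges of n to be glued.
  record ReciprocalBounds {p} (x : ℂ) (P : ℕ → Set p) : Set (c ⊔ ℓ ⊔ p) where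
    field
      radius            : ℝ.Carrier
      radius-positive   : ℝ.0# ℝ.< radius
      constant          : ℝ.Carrier
      constant-nonneg   : ℝ.0# ℝ.≤ constant
      reciprocal-bound  : ∀ n → P n → ∀ h → ∣ h ∣< radius →
        (x + h + fromℕ (suc n)) ≉0 × ∣ (x + h + fromℕ (suc n)) ⁻¹ ∣≤ constant ℝ.* ℝ.1/suc n
  open ReciprocalBounds

  *1/suc-mono : ∀ {C C′} n → C ℝ.≤ C′ → C ℝ.* ℝ.1/suc n ℝ.≤ C′ ℝ.* ℝ.1/suc n
  *1/suc-mono {C} {C′} n C≤C′ = begin
    C ℝ.* ℝ.1/suc n    ≈⟨ ℝ.*-comm _ _ ⟩
    ℝ.1/suc n ℝ.* C    ≤⟨ ℝ.*-monoʳ-≤ (ℝ.<⇒≤ (ℝ.1/suc-positive n)) C≤C′ ⟩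
    ℝ.1/suc n ℝ.* C′   ≈⟨ ℝ.*-comm _ _ ⟩
    C′ ℝ.* ℝ.1/suc n   ∎

  reciprocalBounds-union : ∀ {p q r x} {P : ℕ → Set p} {Q : ℕ → Set q} {R : ℕ → Set r} →
    (∀ n → R n → P n ⊎ Q n) → ReciprocalBounds x P → ReciprocalBounds x Q → ReciprocalBounds x R
  reciprocalBounds-union {x = x} {P} {Q} {R} R⇒P∪Q bP bQ
    with ℝ.common-positive-bound (radius-positive bP) (radius-positive bQ)
  ... | δ , 0<δ , δ≤P , δ≤Q = record
    { radius           = δ
    ; radius-positive  = 0<δ
    ; constant         = C
    ; constant-nonneg  = ℝ.+-nonneg (constant-nonneg bP) (constant-nonneg bQ)
    ; reciprocal-bound = λ n n∈R h h<δ → either n h h<δ (R⇒P∪Q n n∈R)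
    }
    where
    C = constant bP ℝ.+ constant bQ
    either : ∀ n h → ∣ h ∣< δ → P n ⊎ Q n →
      (x + h + fromℕ (suc n)) ≉0 × ∣ (x + h + fromℕ (suc n)) ⁻¹ ∣≤ C ℝ.* ℝ.1/suc n
    either n h h<δ (inj₁ n∈P) =
      proj₁ b , ∣∣≤-mono (*1/suc-mono n (ℝ.x+nonneg (constant-nonneg bQ) ℝ.refl)) (proj₂ b)
      where b = reciprocal-bound bP n n∈P h (∣∣<-mono {h} 0<δ δ≤P h<δ)
    either n h h<δ (inj₂ n∈Q) =
      proj₁ b ,
      ∣∣≤-mono (*1/suc-mono n (ℝ.x+nonneg (constant-nonneg bP) (ℝ.+-comm _ _))) (proj₂ b)
      where b = reciprocal-bound bQ n n∈Q h (∣∣<-mono {h} 0<δ δ≤Q h<δ)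

  reciprocalBounds-at : ∀ x n → (x + fromℕ (suc n)) ≉0 → ReciprocalBounds x (n ≡_)
  reciprocalBounds-at x n z≉0 = record
    { radius           = ℝ.half m
    ; radius-positive  = ℝ.half-positive 0<m
    ; constant         = C
    ; constant-nonneg  = ℝ.*-nonneg (ℝ.+-nonneg 0≤i 0≤i) (ℝ.×1-nonneg (suc n))
    ; reciprocal-bound = λ { _ ≡.refl → b }
    }
    where
    z = x + fromℕ (suc n)
    0<∣z∣² : ℝ.0# ℝ.< ∣ z ∣²
    0<∣z∣² with ∣∣²-nonneg z
    ... | inj₁ 0<∣z∣² = 0<∣z∣²
    ... | inj₂ 0≈∣z∣² = contradiction (ℝ.sym 0≈∣z∣²) (ℝ.sum-of-squares≉0 (proj₁ z) (proj₂ z) z≉0)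
    -- With m ≤ 1 and m ≤ |z|² one gets m² ≤ m ≤ |z|², a positive lower bound for |z| without a
    -- root.
    below = ℝ.common-positive-bound ℝ.0<1 0<∣z∣²
    m = proj₁ below
    0<m = proj₁ (proj₂ below)
    mm≤∣z∣² : m ℝ.* m ℝ.≤ ∣ z ∣²
    mm≤∣z∣² = begin
      m ℝ.* m     ≤⟨ ℝ.*-monoʳ-≤ (ℝ.<⇒≤ 0<m) (proj₁ (proj₂ (proj₂ below))) ⟩
      m ℝ.* ℝ.1#  ≈⟨ ℝ.*-identityʳ m ⟩
      m           ≤⟨ proj₂ (proj₂ (proj₂ below)) ⟩
      ∣ z ∣²      ∎
    i = ℝ.inv m
    0≤i = ℝ.<⇒≤ (ℝ.inv-positive 0<m)
    N = suc n ℝ.×ᴺ ℝ.1#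
    -- Chosen so that C/(n+1) is 2/m, the bound from `perturbed-reciprocal`.
    C = (i ℝ.+ i) ℝ.* N
    2i≈Cq : i ℝ.+ i ℝ.≈ C ℝ.* ℝ.1/suc n
    2i≈Cq = begin-equality
      i ℝ.+ i                            ≈⟨ ℝ.*-identityʳ _ ⟨
      (i ℝ.+ i) ℝ.* ℝ.1#                 ≈⟨ ℝ.*-congˡ (ℝ.1/suc-inverse n) ⟨
      (i ℝ.+ i) ℝ.* (N ℝ.* ℝ.1/suc n)    ≈⟨ ℝ.*-assoc _ _ _ ⟨
      C ℝ.* ℝ.1/suc n                    ∎
    b : ∀ h → ∣ h ∣< ℝ.half m →
      (x + h + fromℕ (suc n)) ≉0 × ∣ (x + h + fromℕ (suc n)) ⁻¹ ∣≤ C ℝ.* ℝ.1/suc n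
    b h h<m/2 =
      (λ x+h+n≈0 → proj₁ z+h (trans {z + h} z+h≈x+h+n x+h+n≈0)) ,
      ∣∣≤-mono (ℝ.≤-reflexive 2i≈Cq) (∣∣≤-cong (⁻¹-cong {z + h} z+h≈x+h+n) (proj₂ z+h))
      where
      z+h≈x+h+n : z + h ≈ x + h + fromℕ (suc n)
      z+h≈x+h+n = x+y+z≈x+z+y x (fromℕ (suc n)) h
      z+h : (z + h) ≉0 × ∣ (z + h) ⁻¹ ∣≤ i ℝ.+ i
      z+h = perturbed-reciprocal {z} {h} 0<m 0≤i (ℝ.inv-inverse m (ℝ.positive⇒≉0 0<m)) mm≤∣z∣²
        (∣∣<⇒∣∣≤ {h} (ℝ.half-positive 0<m) h<m/2)

  reciprocalBounds-below : ∀ x → (∀ n → (x + fromℕ (suc n)) ≉0) → ∀ N →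
    ReciprocalBounds x (ℕ._< N)
  reciprocalBounds-below x x+n≉0 zero = record
    { radius           = ℝ.1#
    ; radius-positive  = ℝ.0<1
    ; constant         = ℝ.0#
    ; constant-nonneg  = ℝ.≤-refl
    ; reciprocal-bound = λ _ ()
    }
  reciprocalBounds-below x x+n≉0 (suc N) =
    reciprocalBounds-union split
      (reciprocalBounds-below x x+n≉0 N) (reciprocalBounds-at x N (x+n≉0 N))
    where
    split : ∀ n → n ℕ.< suc N → n ℕ.< N ⊎ N ≡ n
    split n (ℕ.s≤s n≤N) = Sum.map₂ ≡.sym (ℕ.m≤n⇒m<n∨m≡n n≤N)

  reciprocalBounds-far : ∀ x → ∃ λ N → ReciprocalBounds x (N ℕ.≤_)
  -- For |h| < 1 one has |x + h| ≤ N + 1, and `far-reciprocal` applies beyond twice that bound.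
  reciprocalBounds-far x = suc N ℕ.+ suc N , record
    { radius           = ℝ.1#
    ; radius-positive  = ℝ.0<1
    ; constant         = ℝ.1# ℝ.+ ℝ.1#
    ; constant-nonneg  = ℝ.<⇒≤ (ℝ.+-positive ℝ.0<1 ℝ.0<1)
    ; reciprocal-bound = λ n 2N≤n h h<1 → far-reciprocal {x + h} {suc N} {n}
        (∣∣≤-mono (ℝ.≤-reflexive (ℝ.+-comm _ _))
          (∣∣≤-+ {x} {h} (proj₂ (bounded x)) (∣∣<⇒∣∣≤ {h} ℝ.0<1 h<1)))
        (ℕ.m≤n⇒m≤1+n 2N≤n)
    }
    where N = proj₁ (bounded x)

  reciprocalBounds : ∀ x → (∀ n → (x + fromℕ (suc n)) ≉0) → ReciprocalBounds x (λ _ → ⊤)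
  reciprocalBounds x x+n≉0 = reciprocalBounds-union (λ n _ → split n)
    (reciprocalBounds-below x x+n≉0 N) (proj₂ (reciprocalBounds-far x))
    where
    N = proj₁ (reciprocalBounds-far x)
    split : ∀ n → n ℕ.< N ⊎ N ℕ.≤ n
    split n = ℕ.<-≤-connex n N

  ^ᴿ-nonneg : ∀ {r} → ℝ.0# ℝ.≤ r → ∀ n → ℝ.0# ℝ.≤ r ^ᴿ n
  ^ᴿ-nonneg 0≤r zero    = ℝ.<⇒≤ ℝ.0<1
  ^ᴿ-nonneg 0≤r (suc n) = ℝ.*-nonneg 0≤r (^ᴿ-nonneg 0≤r n)

  module QuotientBounds {C : ℝ.Carrier} (0≤C : ℝ.0# ℝ.≤ C) where
    -- The recursions of `quotient` and `quotient₂` with i and j replaced by C and every minus sign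
    -- by plus.
    quotientConstant : ℕ → ℝ.Carrier
    quotientConstant zero    = ℝ.0#
    quotientConstant (suc a) = C ℝ.* quotientConstant a ℝ.+ C ℝ.* (C ℝ.* C ^ᴿ a)

    quotient₂Constant : ℕ → ℝ.Carrier
    quotient₂Constant zero    = ℝ.0#
    quotient₂Constant (suc a) = C ℝ.* quotient₂Constant a ℝ.+ C ℝ.* quotientConstant (suc a)

    quotientConstant-nonneg : ∀ a → ℝ.0# ℝ.≤ quotientConstant a
    quotientConstant-nonneg zero    = ℝ.≤-refl
    quotientConstant-nonneg (suc a) = ℝ.+-nonneg (ℝ.*-nonneg 0≤C (quotientConstant-nonneg a))
      (ℝ.*-nonneg 0≤C (ℝ.*-nonneg 0≤C (^ᴿ-nonneg 0≤C a)))

    quotient₂Constant-nonneg : ∀ a → ℝ.0# ℝ.≤ quotient₂Constant a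
    quotient₂Constant-nonneg zero    = ℝ.≤-refl
    quotient₂Constant-nonneg (suc a) = ℝ.+-nonneg (ℝ.*-nonneg 0≤C (quotient₂Constant-nonneg a))
      (ℝ.*-nonneg 0≤C (quotientConstant-nonneg (suc a)))

    module _ {i j : ℂ} {q} (0≤q : ℝ.0# ℝ.≤ q) (q≤1 : q ℝ.≤ ℝ.1#)
             (i≤Cq : ∣ i ∣≤ C ℝ.* q) (j≤Cq : ∣ j ∣≤ C ℝ.* q) where
      open DifferenceQuotients i j

      private
        Cq≤C : C ℝ.* q ℝ.≤ C
        Cq≤C = ℝ.≤-trans (ℝ.*-monoʳ-≤ 0≤C q≤1) (ℝ.≤-reflexive (ℝ.*-identityʳ C))
        i≤C = ∣∣≤-mono Cq≤C i≤Cq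
        j≤C = ∣∣≤-mono Cq≤C j≤Cq

      -- Every monomial has at least two factors i or j. Two of them are bounded by Cq and yield q²,
      -- the others by C because q ≤ 1.
      ∣quotient∣≤ : ∀ a → ∣ quotient a ∣≤ quotientConstant a ℝ.* (q ℝ.* q)
      ∣quotient∣≤ zero    = ∣∣≤-mono (ℝ.≤-reflexive (ℝ.sym (ℝ.zeroˡ _))) ∣0∣≤0
      ∣quotient∣≤ (suc a) = ∣∣≤-mono
        (ℝ.≤-reflexive (ℝ.solve 4 (λ C q d p →
           C ℝ.:* (d ℝ.:* (q ℝ.:* q)) ℝ.:+ (C ℝ.:* q) ℝ.:* ((C ℝ.:* q) ℝ.:* p)
             ℝ.:= (C ℝ.:* d ℝ.:+ C ℝ.:* (C ℝ.:* p)) ℝ.:* (q ℝ.:* q))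
           ℝ.refl C q (quotientConstant a) (C ^ᴿ a)))
        (∣∣≤-+ {i * quotient a} {i * (j * j ^ a)} (∣∣≤-* {i} {quotient a} i≤C (∣quotient∣≤ a))
          (∣∣≤-* {i} {j * j ^ a} i≤Cq (∣∣≤-* {j} {j ^ a} j≤Cq (∣^∣≤ a j≤C))))

      ∣quotient₂∣≤ : ∀ a → ∣ quotient₂ a ∣≤ quotient₂Constant a ℝ.* (q ℝ.* q)
      ∣quotient₂∣≤ zero    = ∣∣≤-mono (ℝ.≤-reflexive (ℝ.sym (ℝ.zeroˡ _))) ∣0∣≤0
      ∣quotient₂∣≤ (suc a) = ∣∣≤-mono
        (ℝ.≤-reflexive (ℝ.solve 4 (λ C r g d →
           C ℝ.:* (g ℝ.:* r) ℝ.:+ C ℝ.:* (d ℝ.:* r) ℝ.:= (C ℝ.:* g ℝ.:+ C ℝ.:* d) ℝ.:* r)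
           ℝ.refl C (q ℝ.* q) (quotient₂Constant a) (quotientConstant (suc a))))
        (∣∣≤-+ {i * quotient₂ a} { - (i * quotient (suc a))}
          (∣∣≤-* {i} {quotient₂ a} i≤C (∣quotient₂∣≤ a))
          (∣∣≤-neg {i * quotient (suc a)} (∣∣≤-* {i} {quotient (suc a)} i≤C (∣quotient∣≤ (suc a)))))

-- Finite sums

module FiniteSums {c ℓ} (ℝ : CompleteOrderedField c ℓ) where
  open ComplexNumbers ℝ
  open RingIdentities ℂ-commutativeRing

  ∑-cong : ∀ {F G} → (∀ n → F (suc n) ≈ G (suc n)) → ∀ n → ∑[1… n ] F ≈ ∑[1… n ] G
  ∑-cong F≈G zero    = refl {0#}
  ∑-cong F≈G (suc n) = +-cong (∑-cong F≈G n) (F≈G n)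

  ∑-distribˡ : ∀ k F n → ∑[1… n ] (λ ν → k * F ν) ≈ k * ∑[1… n ] F
  ∑-distribˡ k F zero    = sym {k * 0#} {0#} (zeroʳ k)
  ∑-distribˡ k F (suc n) = trans {∑[1… n ] (λ ν → k * F ν) + k * F (suc n)}
    (+-congʳ {k * F (suc n)} (∑-distribˡ k F n))
    (*-distribˡ-sum k (∑[1… n ] F) (F (suc n)))

  ∑-slope : ∀ F G D k n →
    ∑[1… n ] (λ ν → (F ν - G ν) * k - D ν) ≈ (∑[1… n ] F - ∑[1… n ] G) * k - ∑[1… n ] D
  ∑-slope F G D k zero    = slope-sum-zero k
  ∑-slope F G D k (suc n) = trans {∑[1… suc n ] (λ ν → (F ν - G ν) * k - D ν)}
    (+-congʳ {(F (suc n) - G (suc n)) * k - D (suc n)} (∑-slope F G D k n))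
    (slope-sum-step (∑[1… n ] F) (∑[1… n ] G) (∑[1… n ] D) (F (suc n)) (G (suc n)) (D (suc n)) k)

-- Consequences of the summation axioms

module Summation {c ℓ u} (ℝ : CompleteOrderedField c ℓ) {U : FractionalSums.FunSet ℝ u}
  (σ : FractionalSums.SumMap ℝ U) (axioms : FractionalSums.SatisfiesAxioms ℝ U σ) where
  open FractionalSums ℝ
  open SatisfiesAxioms axioms
  open RingIdentities ℂ-commutativeRing
  open ComplexLimits ℝ
  open SetoidReasoning ℂₛ

  Sum : ∃ (S U) → ℂ → ℂ → ℂ
  Sum f x y = σ ⟨$⟩ (f , x , y)

  shift : ℂ → ∃ (S U) → ∃ (S U)
  shift s (f , f∈S) = translate s f , S-translate s {f} f∈S

  Sum-cong : ∀ f {x x′ y y′} → x ≈ x′ → y ≈ y′ → Sum f x y ≈ Sum f x′ y′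
  Sum-cong f x≈x′ y≈y′ = Func.cong σ ((λ _ → refl) , x≈x′ , y≈y′)

  -- Cutting the sum from x + 1 to x at x yields the same sum twice.
  Sum-empty : ∀ f x → Sum f (x + 1#) x ≈ 0#
  Sum-empty f x = x+x≈x⇒x≈0 {Sum f (x + 1#) x} (continuedSummation f (x + 1#) x x)

  Sum-singleton : ∀ f y → Sum f y y ≈ proj₁ f ⟨$⟩ y
  Sum-singleton f y = begin
    Sum f y y                          ≈⟨ Sum-cong f y≈ y≈ ⟩
    Sum f (1# + s) (1# + s)            ≈⟨ translationInvariance f 1# 1# s ⟩
    Sum (shift s f) 1# 1#              ≈⟨ consistency (shift s f) ⟩
    proj₁ f ⟨$⟩ (1# + s)               ≈⟨ Func.cong (proj₁ f) (1+[x-1]≈x y) ⟩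
    proj₁ f ⟨$⟩ y                      ∎
    where
    s  = y - 1#
    y≈ = sym {1# + s} {y} (1+[x-1]≈x y)

  Sum-finite : ∀ f y n → Sum f (y + 1#) (y + fromℕ n) ≈ ∑[1… n ] λ ν → proj₁ f ⟨$⟩ (y + fromℕ ν)
  Sum-finite f y zero    = begin
    Sum f (y + 1#) (y + 0#)  ≈⟨ Sum-cong f (refl {y + 1#}) (+-identityʳ y) ⟩
    Sum f (y + 1#) y         ≈⟨ Sum-empty f y ⟩
    0#                       ∎
  Sum-finite f y (suc n) = begin
    Sum f (y + 1#) (y + fromℕ (suc n))
      ≈⟨ continuedSummation f (y + 1#) (y + fromℕ n) (y + fromℕ (suc n)) ⟨
    Sum f (y + 1#) (y + fromℕ n) + Sum f (y + fromℕ n + 1#) (y + fromℕ (suc n))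
      ≈⟨ +-cong (Sum-finite f y n)
           (trans {Sum f (y + fromℕ n + 1#) (y + fromℕ (suc n))}
             (Sum-cong f (sym {y + fromℕ (suc n)} (x+[1+n]≈x+n+1 y (fromℕ n)))
                        (refl {y + fromℕ (suc n)}))
             (Sum-singleton f (y + fromℕ (suc n)))) ⟩
    ∑[1… suc n ] (λ ν → proj₁ f ⟨$⟩ (y + fromℕ ν)) ∎

  -- The summand `0#` makes both sums instances of `Sum-finite`, at y = 0 and at y = x.
  partialSum : ∃ (S U) → ℂ → ℕ → ℂ
  partialSum f x n =
    ∑[1… n ] (λ ν → proj₁ f ⟨$⟩ (0# + fromℕ ν)) - ∑[1… n ] (λ ν → proj₁ f ⟨$⟩ (x + fromℕ ν))

  -- The sum from 1 to x + n is cut once after x and once after n. The piece from n + 1 to x + n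
  -- becomes the sum of the shifted function by translation invariance.
  Sum-remainder : ∀ f x n → Sum f 1# x - Sum (shift (fromℕ n) f) 1# x ≈ partialSum f x n
  Sum-remainder f x n = split-sum {Sum f 1# x} {A} {B} {R} {Sum f 1# (x + fromℕ n)}
    (begin
      Sum f 1# x + B
        ≈⟨ +-congˡ {Sum f 1# x} (Sum-finite f x n) ⟨
      Sum f 1# x + Sum f (x + 1#) (x + fromℕ n)
        ≈⟨ continuedSummation f 1# x (x + fromℕ n) ⟩
      Sum f 1# (x + fromℕ n) ∎)
    (begin
      A + R
        ≈⟨ +-cong (Sum-finite f 0# n) (translationInvariance f 1# x (fromℕ n)) ⟨
      Sum f (0# + 1#) (0# + fromℕ n) + Sum f (1# + fromℕ n) (x + fromℕ n)
        ≈⟨ +-cong (Sum-cong f (+-identityˡ 1#) (refl {0# + fromℕ n}))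
             (Sum-cong f (sym {0# + fromℕ n + 1#} (0+n+1≈1+n (fromℕ n))) (refl {x + fromℕ n})) ⟩
      Sum f 1# (0# + fromℕ n) + Sum f (0# + fromℕ n + 1#) (x + fromℕ n)
        ≈⟨ continuedSummation f 1# (0# + fromℕ n) (x + fromℕ n) ⟩
      Sum f 1# (x + fromℕ n) ∎)
    where
    A = ∑[1… n ] λ ν → proj₁ f ⟨$⟩ (0# + fromℕ ν)
    B = ∑[1… n ] λ ν → proj₁ f ⟨$⟩ (x + fromℕ ν)
    R = Sum (shift (fromℕ n) f) 1# x

  partialSum⟶Sum : ∀ f → (∀ t → (λ n → proj₁ f ⟨$⟩ (t + fromℕ n)) ⟶ 0#) →
    ∀ x → partialSum f x ⟶ Sum f 1# x
  partialSum⟶Sum f f⟶0 x =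
    ⟶-cong
      {λ n → Sum f 1# x - Sum (shift (fromℕ n) f) 1# x} {partialSum f x}
      {Sum f 1# x - 0#} {Sum f 1# x}
      (Sum-remainder f x) (x-0≈x (Sum f 1# x))
      (⟶-difference {λ _ → Sum f 1# x} {λ n → Sum (shift (fromℕ n) f) 1# x} {Sum f 1# x} {0#}
        (⟶-constant (Sum f 1# x)) (nullShiftRegularity f f⟶0 1# x))

-- Values and decay of the inverse powers, and the series of ζ

module InversePowers {c ℓ} (ℝ : CompleteOrderedField c ℓ) where
  open FractionalSums ℝ
  open RingIdentities ℂ-commutativeRing
  open ComplexBounds ℝ
  open ComplexLimits ℝ
  open Exp ℝ.semiring renaming (_^_ to _^ᴿ_) using ()
  open SetoidReasoning ℂₛ

  ^-≉0 : ∀ {z} n → z ≉0 → (z ^ n) ≉0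
  ^-≉0 {z} n z≉0 zⁿ≈0 = fromℕ-suc≉0 0 (begin
    1# + 0#            ≈⟨ +-identityʳ 1# ⟩
    1#                 ≈⟨ ^-inverse {z} {z ⁻¹} n (⁻¹-inverse z z≉0) ⟨
    z ^ n * z ⁻¹ ^ n   ≈⟨ *-congʳ {z ⁻¹ ^ n} {z ^ n} {0#} zⁿ≈0 ⟩
    0# * z ⁻¹ ^ n      ≈⟨ zeroˡ (z ⁻¹ ^ n) ⟩
    0#                 ∎)

  ^-⁻¹ : ∀ {z} n → z ≉0 → (z ^ n) ⁻¹ ≈ z ⁻¹ ^ n
  ^-⁻¹ {z} n z≉0 = *-inverse-unique {z ^ n} {(z ^ n) ⁻¹} {z ⁻¹ ^ n}
    (⁻¹-inverse (z ^ n) (^-≉0 n z≉0)) (^-inverse {z} {z ⁻¹} n (⁻¹-inverse z z≉0))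

  invPow-value : ∀ a {z} → z ≉0 → invPow a ⟨$⟩ z ≈ z ⁻¹ ^ a
  invPow-value a {z} z≉0 with z ≟ 0#
  ... | yes z≈0 = contradiction z≈0 z≉0
  ... | no  _   = trans {1# * (z ^ a) ⁻¹} (*-identityˡ ((z ^ a) ⁻¹)) (^-⁻¹ a z≉0)

  invPow′-value : ∀ a {z} → z ≉0 → invPow′ a ⟨$⟩ z ≈ - 1# * (fromℕ a * z ⁻¹ ^ suc a)
  invPow′-value a {z} z≉0 with z ≟ 0#
  ... | yes z≈0 = contradiction z≈0 z≉0
  ... | no  _   = trans { - (fromℕ a * (z ^ suc a) ⁻¹)}
    (-‿cong (*-congˡ {fromℕ a} (^-⁻¹ (suc a) z≉0)))
    (sym { - 1# * (fromℕ a * z ⁻¹ ^ suc a)} (-x≈-1*x (fromℕ a * z ⁻¹ ^ suc a)))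

  -- One factor 1/z supplies the decay 2/(n+1); the other b factors are bounded by 2.
  inverse-power-decay : ∀ (f : Fun) k b → (∀ {z} → z ≉0 → f ⟨$⟩ z ≈ k * z ⁻¹ ^ suc b) →
    ∀ t → (λ n → f ⟨$⟩ (t + fromℕ n)) ⟶ 0#
  inverse-power-decay f k b f≈ t = O[1/n]⟶0 (K ℝ.* (2# ℝ.* 2# ^ᴿ b)) (N ℕ.+ N)
    -- A modulus bound carries the nonnegativity of its right-hand side, so the constant's sign is
    -- read off from a bound for k(1+1)(1+1)ᵇ.
    (nonneg (∣∣≤-* (∣∣≤-1+square k) (∣∣≤-* ∣2∣≤ (∣^∣≤ b ∣2∣≤)))) λ n 2N≤n →
      let z = t + fromℕ (suc n)
          (z≉0 , i≤) = far-reciprocal {t} {N} {n} (proj₂ (bounded t)) (ℕ.m≤n⇒m≤1+n 2N≤n)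
      in ∣∣≤-cong {k * z ⁻¹ ^ suc b} {f ⟨$⟩ z} (sym {f ⟨$⟩ z} (f≈ z≉0))
           (∣∣≤-mono (ℝ.≤-reflexive (rearrange (ℝ.1/suc n)))
             (∣∣≤-* {k} {z ⁻¹ ^ suc b} (∣∣≤-1+square k)
               (∣∣≤-* {z ⁻¹} {z ⁻¹ ^ b} i≤ (∣^∣≤ b (∣∣≤-mono (2q≤2 n) i≤)))))
    where
    N = proj₁ (bounded t)
    K = ℝ.1# ℝ.+ ∣ k ∣²
    2# = ℝ.1# ℝ.+ ℝ.1#
    ∣2∣≤ : ∣ 1# + 1# ∣≤ 2#
    ∣2∣≤ = ∣∣≤-+ {1#} {1#} ∣1∣≤1 ∣1∣≤1
    2q≤2 : ∀ n → 2# ℝ.* ℝ.1/suc n ℝ.≤ 2#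
    2q≤2 n = ℝ.≤-trans (ℝ.*-monoʳ-≤ (nonneg ∣2∣≤) (ℝ.1/suc≤1 n)) (ℝ.≤-reflexive (ℝ.*-identityʳ 2#))
    rearrange : ∀ q → K ℝ.* ((2# ℝ.* q) ℝ.* 2# ^ᴿ b) ℝ.≈ K ℝ.* (2# ℝ.* 2# ^ᴿ b) ℝ.* q
    rearrange q = ℝ.solve 4 (λ K t p q → K ℝ.:* ((t ℝ.:* q) ℝ.:* p) ℝ.:= K ℝ.:* (t ℝ.:* p) ℝ.:* q)
      ℝ.refl K 2# (2# ^ᴿ b) q

  invPow⟶0 : ∀ b t → (λ n → invPow (suc b) ⟨$⟩ (t + fromℕ n)) ⟶ 0#
  invPow⟶0 b = inverse-power-decay (invPow (suc b)) 1# b λ {z} z≉0 →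
    trans {invPow (suc b) ⟨$⟩ z} (invPow-value (suc b) z≉0)
      (sym {1# * z ⁻¹ ^ suc b} (*-identityˡ (z ⁻¹ ^ suc b)))

  invPow′⟶0 : ∀ a t → (λ n → invPow′ a ⟨$⟩ (t + fromℕ n)) ⟶ 0#
  invPow′⟶0 a = inverse-power-decay (invPow′ a) (- 1# * fromℕ a) a λ {z} z≉0 →
    trans {invPow′ a ⟨$⟩ z} (invPow′-value a z≉0)
      (sym { - 1# * fromℕ a * z ⁻¹ ^ suc a} (*-assoc (- 1#) (fromℕ a) (z ⁻¹ ^ suc a)))

  ∣fromℕ-suc⁻¹∣≤ : ∀ n → ∣ fromℕ (suc n) ⁻¹ ∣≤ ℝ.1/suc n
  ∣fromℕ-suc⁻¹∣≤ n = proj₂ (∣⁻¹∣≤ {fromℕ (suc n)} (ℝ.×1-nonneg (suc n)) (ℝ.<⇒≤ (ℝ.1/suc-positive n))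
    (ℝ.1/suc-inverse n) (ℝ.≤-reflexive (ℝ.sym (∣fromℕ∣² (suc n)))))

  ζ-converges : ∀ b → Converges (λ N → ∑[1… N ] λ n → 1# / fromℕ n ^ suc (suc b))
  ζ-converges b = cauchy⇒converges {λ N → ∑[1… N ] F} K 0≤K (∑-tail-bound {F} K 0≤K F≤)
    where
    F : ℕ → ℂ
    F n = 1# / fromℕ n ^ suc (suc b)
    -- Two of the b + 2 factors 1/n give the square; the remaining b, each at most 1, give this
    -- constant.
    K = ℝ.1# ^ᴿ b
    0≤K = nonneg (∣^∣≤ {1#} b ∣1∣≤1)
    F≤ : ∀ n → ∣ F (suc n) ∣≤ K ℝ.* (ℝ.1/suc n ℝ.* ℝ.1/suc n)
    F≤ n = ∣∣≤-cong {i * (i * i ^ b)} {F (suc n)}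
      (sym {F (suc n)} (trans {F (suc n)} (*-identityˡ ((z ^ suc (suc b)) ⁻¹))
        (^-⁻¹ (suc (suc b)) (fromℕ-suc≉0 n))))
      (∣∣≤-mono
        (ℝ.≤-reflexive (ℝ.solve 2 (λ q K → q ℝ.:* (q ℝ.:* K) ℝ.:= K ℝ.:* (q ℝ.:* q))
          ℝ.refl (ℝ.1/suc n) K))
        (∣∣≤-* {i} {i * i ^ b} i≤q
          (∣∣≤-* {i} {i ^ b} i≤q (∣^∣≤ {i} b (∣∣≤-mono (ℝ.1/suc≤1 n) i≤q)))))
      where
      z = fromℕ (suc n)
      i = z ⁻¹
      i≤q = ∣fromℕ-suc⁻¹∣≤ n

-- The derivative and the essence of the fractional sum

module Derivatives {c ℓ r} (ℝ : CompleteOrderedField c ℓ) {U : FractionalSums.FunSet ℝ r}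
  (summable : FractionalSums.SummableSet ℝ U) (b : ℕ)
  (f∈ : FractionalSums.invPow ℝ (suc b) ∈ FractionalSums.S ℝ U)
  (f′∈ : FractionalSums.invPow′ ℝ (suc b) ∈ FractionalSums.S ℝ U) where
  open FractionalSums ℝ
  open SummableSet summable
  open Summation ℝ sumMap axioms
  open RingIdentities ℂ-commutativeRing
  open ComplexBounds ℝ
  open ComplexLimits ℝ
  open FiniteSums ℝ
  open Reciprocals ℝ
  open ReciprocalBounds
  open InversePowers ℝ

  a : ℕ
  a = suc b

  F F′ : ℂ → ℂ
  F  = sum (invPow a) f∈ 1#
  F′ = sum (invPow′ a) f′∈ 1#

  -- The value -f_a′(x+ν) when x + ν ≠ 0. The sign fits because the partial sums subtract f_a(x+ν).
  negDerivative : ℂ → ℕ → ℂ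
  negDerivative x ν = fromℕ a * (x + fromℕ ν) ⁻¹ ^ suc a

  -- The limit d is a parameter because it is identified in two ways: as a ζ(a+1) at x = 0, and
  -- through the axioms for f_a′ at general x.
  module Slope (x d : ℂ) (D⟶d : (λ n → ∑[1… n ] (negDerivative x)) ⟶ d)
    (bounds : ReciprocalBounds x (λ _ → ⊤)) where

    open QuotientBounds (constant-nonneg bounds)
    G = quotient₂Constant a

    term : ℂ → ℕ → ℂ
    term h ν =
      ((invPow a ⟨$⟩ (x + fromℕ ν)) - (invPow a ⟨$⟩ (x + h + fromℕ ν))) * h ⁻¹ - negDerivative x ν

    ∑term⟶ : ∀ h → (λ n → ∑[1… n ] (term h)) ⟶ ((F (x + h) - F x) / h - d)
    ∑term⟶ h = ⟶-cong
      {λ n → h ⁻¹ * ΔP n - ∑[1… n ] (negDerivative x)} {λ n → ∑[1… n ] (term h)}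
      {h ⁻¹ * (F (x + h) - F x) - d} {(F (x + h) - F x) / h - d}
      (λ n → sym {∑[1… n ] (term h)} (∑term≈ n))
      (+-congʳ { - d} (*-comm (h ⁻¹) (F (x + h) - F x)))
      (⟶-difference {λ n → h ⁻¹ * ΔP n} {λ n → ∑[1… n ] (negDerivative x)} {h ⁻¹ * (F (x + h) - F x)} {d}
        (⟶-* (h ⁻¹) {ΔP} {F (x + h) - F x}
          (⟶-difference {partialSum f (x + h)} {partialSum f x} {F (x + h)} {F x}
            (partialSum⟶Sum f (invPow⟶0 b) (x + h)) (partialSum⟶Sum f (invPow⟶0 b) x)))
        D⟶d)
      where
      open SetoidReasoning ℂₛ
      f : ∃ (S U)
      f = invPow a , f∈
      ΔP : ℕ → ℂ
      ΔP n = partialSum f (x + h) n - partialSum f x n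
      values : ℂ → ℕ → ℂ
      values y ν = invPow a ⟨$⟩ (y + fromℕ ν)
      ∑term≈ : ∀ n → ∑[1… n ] (term h) ≈ h ⁻¹ * ΔP n - ∑[1… n ] (negDerivative x)
      ∑term≈ n = begin
        ∑[1… n ] (term h)
          ≈⟨ ∑-slope (values x) (values (x + h)) (negDerivative x) (h ⁻¹) n ⟩
        (t - v) * h ⁻¹ - D
          ≈⟨ slope-of-differences s t v (h ⁻¹) D ⟩
        ΔP n * h ⁻¹ - D
          ≈⟨ +-congʳ { - D} (*-comm (ΔP n) (h ⁻¹)) ⟩
        h ⁻¹ * ΔP n - D ∎
        where
        s = ∑[1… n ] (values 0#)
        t = ∑[1… n ] (values x)
        v = ∑[1… n ] (values (x + h))
        D = ∑[1… n ] (negDerivative x)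

    ∣term∣≤ : ∀ {δ} h → ℝ.0# ℝ.< δ → δ ℝ.≤ radius bounds → h ≉0 → ∣ h ∣< δ → ∀ n →
      ∣ term h (suc n) ∣≤ (δ ℝ.* G) ℝ.* (ℝ.1/suc n ℝ.* ℝ.1/suc n)
    ∣term∣≤ {δ} h 0<δ δ≤r h≉0 h<δ n =
      ∣∣≤-cong {h * quotient₂ a} {term h (suc n)} (sym {term h (suc n)} term≈)
        (∣∣≤-mono (ℝ.≤-reflexive (ℝ.sym (ℝ.*-assoc δ G (ℝ.1/suc n ℝ.* ℝ.1/suc n))))
          (∣∣≤-* {h} {quotient₂ a} (∣∣<⇒∣∣≤ {h} 0<δ h<δ)
            (∣quotient₂∣≤ {i} {j} (ℝ.<⇒≤ (ℝ.1/suc-positive n)) (ℝ.1/suc≤1 n) i≤ j≤ a)))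
      where
      open SetoidReasoning ℂₛ
      z w i j : ℂ
      z = x + fromℕ (suc n)
      w = x + h + fromℕ (suc n)
      i = z ⁻¹
      j = w ⁻¹
      open DifferenceQuotients i j
      x+0+n≈z : x + 0# + fromℕ (suc n) ≈ z
      x+0+n≈z = +-congʳ {fromℕ (suc n)} (+-identityʳ x)
      -- The instance h = 0 bounds i = 1/(x+ν) with the same constant as j = 1/(x+h+ν).
      at-0 = reciprocal-bound bounds n tt 0# (∣∣≤⇒∣∣< ∣0∣≤0 (radius-positive bounds))
      at-h = reciprocal-bound bounds n tt h (∣∣<-mono {h} 0<δ δ≤r h<δ)
      z≉0 : z ≉0
      z≉0 z≈0 = proj₁ at-0 (trans {x + 0# + fromℕ (suc n)} x+0+n≈z z≈0)
      i≤ : ∣ i ∣≤ constant bounds ℝ.* ℝ.1/suc n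
      i≤ = ∣∣≤-cong {(x + 0# + fromℕ (suc n)) ⁻¹} {i}
        (⁻¹-cong {x + 0# + fromℕ (suc n)} {z} x+0+n≈z) (proj₂ at-0)
      w≉0 : w ≉0
      w≉0 = proj₁ at-h
      j≤ : ∣ j ∣≤ constant bounds ℝ.* ℝ.1/suc n
      j≤ = proj₂ at-h
      term≈ : term h (suc n) ≈ h * quotient₂ a
      term≈ = begin
        ((invPow a ⟨$⟩ z) - (invPow a ⟨$⟩ w)) * h ⁻¹ - negDerivative x (suc n)
          ≈⟨ +-congʳ { - negDerivative x (suc n)} (*-congʳ {h ⁻¹}
               (+-cong (invPow-value a z≉0) (-‿cong (invPow-value a w≉0)))) ⟩
        (i ^ a - j ^ a) * h ⁻¹ - fromℕ a * i ^ suc a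
          ≈⟨ slope-error {h} (reciprocal-difference {z} {w} {h} {i} {j}
               (x+y+z≈x+z+y x h (fromℕ (suc n))) (⁻¹-inverse z z≉0) (⁻¹-inverse w w≉0))
               {h ⁻¹} a (⁻¹-inverse h h≉0) ⟩
        h * quotient₂ a ∎

    -- This is the exchange of limits: the partial sums of `term h` are at most ε/2 uniformly in n,
    -- and the other ε/2 is the slack spent in passing to their limit.
    hasDerivative : HasDerivativeAt F x d
    hasDerivative ε 0<ε = δ , 0<δ , λ h h≉0 h<δ →
      ℝ.<-respʳ-≈ (ℝ.*-cong (ℝ.half+half ε) (ℝ.half+half ε))
        (⟶-bound {λ n → ∑[1… n ] (term h)} {(F (x + h) - F x) / h - d} (∑term⟶ h)
          (λ n → ∣∣≤-mono δG≤ε/2 (∑-bound {term h} (δ ℝ.* G) 0≤δG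
            (∣term∣≤ h 0<δ (proj₁ (proj₂ (proj₂ below))) h≉0 h<δ) n))
          (ℝ.half-positive 0<ε))
      where
      open StrictReasoning ℝ.strictPartialOrder
      0≤G = quotient₂Constant-nonneg a
      M = G ℝ.* tail 0
      0≤M = ℝ.*-nonneg 0≤G (tail-nonneg 0)
      0<1+M = ℝ.<-≤-trans ℝ.0<1 (ℝ.x+nonneg 0≤M ℝ.refl)
      -- M is known only to be nonnegative, so 1 + M is inverted in its place.
      δ₁ = ℝ.half ε ℝ.* ℝ.inv (ℝ.1# ℝ.+ M)
      below = ℝ.common-positive-bound (radius-positive bounds)
        (ℝ.*-positive (ℝ.half-positive 0<ε) (ℝ.inv-positive 0<1+M))
      δ = proj₁ below
      0<δ = proj₁ (proj₂ below)
      0≤δG = ℝ.*-nonneg (ℝ.<⇒≤ 0<δ) 0≤G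
      δG≤ε/2 : (δ ℝ.* G) ℝ.* tail 0 ℝ.≤ ℝ.half ε
      δG≤ε/2 = begin
        (δ ℝ.* G) ℝ.* tail 0
          ≈⟨ ℝ.*-assoc δ G (tail 0) ⟩
        δ ℝ.* M
          ≤⟨ ℝ.*-mono-≤ (ℝ.<⇒≤ 0<δ) (ℝ.<⇒≤ 0<1+M) (proj₂ (proj₂ (proj₂ below)))
               (ℝ.x+nonneg (ℝ.<⇒≤ ℝ.0<1) (ℝ.+-comm ℝ.1# M)) ⟩
        δ₁ ℝ.* (ℝ.1# ℝ.+ M)
          ≈⟨ ℝ.solve 3 (λ e i m → (e ℝ.:* i) ℝ.:* m ℝ.:= m ℝ.:* i ℝ.:* e)
               ℝ.refl (ℝ.half ε) (ℝ.inv (ℝ.1# ℝ.+ M)) (ℝ.1# ℝ.+ M) ⟩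
        (ℝ.1# ℝ.+ M) ℝ.* ℝ.inv (ℝ.1# ℝ.+ M) ℝ.* ℝ.half ε
          ≈⟨ ℝ.x*invx*y≈y (ℝ.half ε) 0<1+M ⟩
        ℝ.half ε ∎

  ζ ess : ℂ
  ζ   = proj₁ (ζ-converges b)
  ess = fromℕ a * ζ

  x+n≉0 : ∀ {x} → x ∉ NegativeInteger → ∀ n → (x + fromℕ (suc n)) ≉0
  x+n≉0 {x} x∉ n x+n≈0 = x∉ (n , RingProperties.+-inverseˡ-unique ring x (fromℕ (suc n)) x+n≈0)

  0∉NegativeInteger : 0# ∉ NegativeInteger
  0∉NegativeInteger (n , 0≈-n) = fromℕ-suc≉0 n (begin
    m          ≈⟨ +-identityˡ m ⟨
    0# + m     ≈⟨ +-congʳ {m} {0#} { - m} 0≈-n ⟩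
    - m + m    ≈⟨ -‿inverseˡ m ⟩
    0#         ∎)
    where
    open SetoidReasoning ℂₛ
    m = fromℕ (suc n)

  ∑negDerivative-at-0 : ∀ n →
    fromℕ a * ∑[1… n ] (λ ν → 1# / fromℕ ν ^ suc a) ≈ ∑[1… n ] (negDerivative 0#)
  ∑negDerivative-at-0 n = begin
    fromℕ a * ∑[1… n ] (λ ν → 1# / fromℕ ν ^ suc a)
      ≈⟨ ∑-distribˡ (fromℕ a) (λ ν → 1# / fromℕ ν ^ suc a) n ⟨
    ∑[1… n ] (λ ν → fromℕ a * (1# / fromℕ ν ^ suc a))
      ≈⟨ ∑-cong {λ ν → fromℕ a * (1# / fromℕ ν ^ suc a)} {negDerivative 0#}
           (λ k → *-congˡ {fromℕ a} (at (fromℕ (suc k)) (fromℕ-suc≉0 k))) n ⟩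
    ∑[1… n ] (negDerivative 0#) ∎
    where
    open SetoidReasoning ℂₛ
    at : ∀ z → z ≉0 → 1# / z ^ suc a ≈ (0# + z) ⁻¹ ^ suc a
    at z z≉0 = begin
      1# * (z ^ suc a) ⁻¹     ≈⟨ *-identityˡ ((z ^ suc a) ⁻¹) ⟩
      (z ^ suc a) ⁻¹          ≈⟨ ^-⁻¹ (suc a) z≉0 ⟩
      z ⁻¹ ^ suc a            ≈⟨ ^-congˡ (suc a) (⁻¹-cong {z} {0# + z} (sym {0# + z} (+-identityˡ z))) ⟩
      (0# + z) ⁻¹ ^ suc a     ∎

  ∑negDerivative⟶ess : (λ n → ∑[1… n ] (negDerivative 0#)) ⟶ ess
  ∑negDerivative⟶ess = ⟶-cong
    {λ n → fromℕ a * ∑[1… n ] (λ ν → 1# / fromℕ ν ^ suc a)}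
    {λ n → ∑[1… n ] (negDerivative 0#)} {ess}
    ∑negDerivative-at-0 (refl {ess})
    (⟶-* (fromℕ a) {λ n → ∑[1… n ] (λ ν → 1# / fromℕ ν ^ suc a)} {ζ} (proj₂ (ζ-converges b)))

  ∑invPow′ : ∀ {x} → x ∉ NegativeInteger → ∀ n →
    ∑[1… n ] (λ ν → invPow′ a ⟨$⟩ (x + fromℕ ν)) ≈ - 1# * ∑[1… n ] (negDerivative x)
  ∑invPow′ {x} x∉ n = trans {∑[1… n ] (λ ν → invPow′ a ⟨$⟩ (x + fromℕ ν))}
    (∑-cong {λ ν → invPow′ a ⟨$⟩ (x + fromℕ ν)} {λ ν → - 1# * negDerivative x ν}
      (λ k → invPow′-value a (x+n≉0 x∉ k)) n)
    (∑-distribˡ (- 1#) (negDerivative x) n)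

  -- Convergence at x is inherited from 0: `partialSum f′ x n` equals `D n` minus `D₀ n`, and its
  -- limit is `F′ x`.
  ∑negDerivative⟶ : ∀ {x} → x ∉ NegativeInteger →
    (λ n → ∑[1… n ] (negDerivative x)) ⟶ (ess + F′ x)
  ∑negDerivative⟶ {x} x∉ = ⟶-cong
    {λ n → D₀ n + partialSum f′ x n} {D} {ess + F′ x} ≈D (refl {ess + F′ x})
    (⟶-+ {D₀} {partialSum f′ x} {ess} {F′ x} ∑negDerivative⟶ess
      (partialSum⟶Sum f′ (invPow′⟶0 a) x))
    where
    f′ : ∃ (S U)
    f′ = invPow′ a , f′∈
    D₀ D : ℕ → ℂ
    D₀ n = ∑[1… n ] (negDerivative 0#)
    D n  = ∑[1… n ] (negDerivative x)
    ≈D : ∀ n → D₀ n + partialSum f′ x n ≈ D n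
    ≈D n = trans {D₀ n + partialSum f′ x n}
      (+-congˡ {D₀ n} (+-cong (∑invPow′ 0∉NegativeInteger n) (-‿cong (∑invPow′ x∉ n))))
      (x-[x-y]≈y (D₀ n) (D n))

  F-hasDerivative : ∀ {x} d → x ∉ NegativeInteger → (λ n → ∑[1… n ] (negDerivative x)) ⟶ d →
    HasDerivativeAt F x d
  F-hasDerivative {x} d x∉ D⟶d = Slope.hasDerivative x d D⟶d (reciprocalBounds x (x+n≉0 x∉))

  -- The essence is the derivative of `F` at 0, because `F 0#` is the empty sum from 1 to 0.
  F-essence : IsEssence (invPow a) f∈ ess
  F-essence ε 0<ε = proj₁ F′0 , proj₁ (proj₂ F′0) , λ h h≉0 h<δ →
    ∣∣<-cong {(F (0# + h) - F 0#) / h - ess} {1# / h * F h - ess} (slope≈ h)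
      (proj₂ (proj₂ F′0) h h≉0 h<δ)
    where
    open SetoidReasoning ℂₛ
    f : ∃ (S U)
    f = invPow a , f∈
    F′0 = F-hasDerivative ess 0∉NegativeInteger ∑negDerivative⟶ess ε 0<ε
    F0≈0 : F 0# ≈ 0#
    F0≈0 = begin
      Sum f 1# 0#           ≈⟨ Sum-cong f (+-identityˡ 1#) (refl {0#}) ⟨
      Sum f (0# + 1#) 0#    ≈⟨ Sum-empty f 0# ⟩
      0#                    ∎
    slope≈ : ∀ h → (F (0# + h) - F 0#) / h - ess ≈ 1# / h * F h - ess
    slope≈ h = +-congʳ { - ess} (begin
      (F (0# + h) - F 0#) / h    ≈⟨ slope-at-zero {F 0#} (F (0# + h)) (h ⁻¹) F0≈0 ⟩
      1# / h * F (0# + h)        ≈⟨ *-congˡ {1# / h} (Sum-cong f (refl {1#}) (+-identityˡ h)) ⟩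
      1# / h * F h               ∎)

open import Data.Nat.Base using (_≤_)

theorem4p3p5 : ∀ {c ℓ u} (ℝ : CompleteOrderedField c ℓ) →
    let open FractionalSums ℝ in
    (a : ℕ) → 1 ≤ a →
    (U : FunSet u) (summable : SummableSet U) →
    let open SummableSet summable in
    (f∈ : invPow a ∈ S U) (f′∈ : invPow′ a ∈ S U) →
    ∃ λ ess → ∃ λ ζ →
    IsEssence (invPow a) f∈ ess ×
    IsZetaValue (suc a) ζ ×
    ess ≈ fromℕ a * ζ ×
    (∀ x → x ∉ NegativeInteger →
    HasDerivativeAt (sum (invPow a) f∈ 1#) x (ess + sum (invPow′ a) f′∈ 1# x))
theorem4p3p5 ℝ (suc b) _ U summable f∈ f′∈ =
  ess , ζ , F-essence , proj₂ (ζ-converges b) , refl {ess} ,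
  λ x x∉ → F-hasDerivative {x} (ess + F′ x) x∉ (∑negDerivative⟶ x∉)
  where
  open FractionalSums ℝ
  open InversePowers ℝ using (ζ-converges)
  open Derivatives ℝ summable b f∈ f′∈
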